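{- For every integer $n\geq 1$, the polynomials $Q_n(x)$, $S_n(x)$ and $T_n(x)$ are all unimodal with modes in the middle; that is, each of these polynomials $f(x)$, of degree $d$ (where $d=2n-1$ for $Q_n$ and $S_n$, and $d=2n$ for $T_n$), is unimodal and has the index $\lfloor (d+1)/2\rfloor$ (which equals $n$ in all three cases) as a mode.
   Context: A polynomial $f(x)=\sum_{i=0}^d f_ix^i$ with nonnegative coefficients is unimodal with mode $m$ if $f_0\leq f_1\leq\cdots\leq f_m\geq f_{m+1}\geq\cdots\geq f_d$. Let $\mathfrak{D}_n$ be the set of permutations (rearrangements) $\sigma=\sigma_1\cdots\sigma_{2n+1}$ of the multiset $\{1,1,2,2,\ldots,n,n,n+1\}$. For $\sigma\in\mathfrak{D}_n$, $\mathrm{des}(\sigma)=\#\{i\in\{1,\ldots,2n\}:\sigma_i>\sigma_{i+1}\}$, and $Q_n(x)=\sum_{\sigma\in\mathfrak{D}_n}x^{\mathrm{des}(\sigma)}$. Let $\mathcal{C}_n^{\pm}$ be the set of all distinct signed permutations of the multiset $\{1,1,2,2,\ldots,n,n\}$, i.e. all words $\pm\sigma_1\pm\sigma_2\cdots\pm\sigma_{2n}$ with $\sigma_1\cdots\sigma_{2n}$ a permutation of $\{1,1,\ldots,n,n\}$ and each sign chosen arbitrarily. Let $\mathfrak{D}_n^{\pm}$ be the set of signed permutations of the multiset $\{1,1,2,2,\ldots,n,n,n+1\}$ in which the entry $n+1$ has a positive sign (equivalently, words obtained from an element of $\mathcal{C}_n^{\pm}$ by inserting the entry $n+1$). For a signed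 word $\sigma=\sigma_1\cdots\sigma_m$ set $\sigma_0=0$ and $\mathrm{des}_B(\sigma)=\#\{i\in\{0,1,\ldots,m-1\}:\sigma_i>\sigma_{i+1}\}$. Define $S_n(x)=\sum_{\sigma\in\mathcal{C}_n^{\pm}}x^{\mathrm{des}_B(\sigma)}$ and $T_n(x)=\sum_{\sigma\in\mathfrak{D}_n^{\pm}}x^{\mathrm{des}_B(\sigma)}$. -}

module Defs where

open import Data.Bool using (if_then_else_)
open import Data.Integer as ℤ using (ℤ; +_; -[1+_]; 0ℤ; ∣_∣)
import Data.Integer.Properties as ℤ
open import Data.List using (List; []; _∷_; _++_; [_]; length; map; filter; concatMap; upTo; cartesianProductWith)
open import Data.List.Properties using (length-map; ∷-injective)
open import Data.List.Membership.Propositional using (_∈_)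
open import Data.List.Membership.Propositional.Properties using (∈-∃++; ∈-map⁺; ∈-map⁻; ∈-++⁺ˡ; ∈-++⁺ʳ; ∈-++⁻; ∈-upTo⁺; ∈-upTo⁻; ∈-filter⁺; ∈-filter⁻; ∈-cartesianProductWith⁺)
import Data.List.Membership.DecPropositional as DecMembership
open import Data.List.Relation.Binary.Permutation.Propositional using (_↭_; ↭-refl; ↭-sym; ↭-trans; prep)
open import Data.List.Relation.Binary.Permutation.Propositional.Properties using (shift; drop-∷; ∈-resp-↭; ↭-length; ¬x∷xs↭[])
open import Data.List.Relation.Unary.All using ([]; _∷_)
open import Data.List.Relation.Unary.Any using (here; there)
open import Data.List.Relation.Unary.AllPairs using ([]; _∷_)
open import Data.List.Relation.Unary.Unique.Propositional using (Unique)
import Data.List.Relation.Unary.Unique.Propositional.Properties as Unique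
open import Data.Nat using (ℕ; zero; suc; _+_; _≤_; _<_; _<?_; _≟_; ⌊_/2⌋)
open import Data.Nat.Properties using (suc-injective; m<n⇒m<1+n; n<1+n)
open import Data.Product using (_×_; _,_; proj₁; proj₂; ∃)
open import Data.Sum using (inj₁; inj₂)
open import Function using (_∘_; _⇔_; mk⇔)
open import Relation.Binary using (Decidable; Rel)
open import Relation.Binary.PropositionalEquality using (_≡_; _≢_; refl; sym; trans; subst)
open import Relation.Nullary using (yes; no; does; ¬_)
open import Relation.Nullary.Decidable using (_×-dec_; map′)
open import Relation.Unary using (Pred) renaming (Decidable to Decidable₁)
open import Level using (0ℓ)

-- A polynomial with natural coefficients is given by its coefficient function
-- i ↦ fᵢ; `HasDegree` supplies finite support.
Poly : Set
Poly = ℕ → ℕ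

HasDegree : Poly → ℕ → Set
HasDegree f d = f d ≢ 0 × (∀ i → d < i → f i ≡ 0)

-- f₀ ≤ f₁ ≤ ⋯ ≤ fₘ ≥ fₘ₊₁ ≥ ⋯ ≥ f_d
UnimodalWithMode : Poly → (d m : ℕ) → Set
UnimodalWithMode f d m =
  m ≤ d ×
  (∀ i → i < m → f i ≤ f (suc i)) ×
  (∀ i → m ≤ i → i < d → f (suc i) ≤ f i)

UnimodalWithModeInTheMiddle : Poly → ℕ → Set
UnimodalWithModeInTheMiddle f d =
  HasDegree f d × UnimodalWithMode f d ⌊ d + 1 /2⌋

-- Σ_{σ ∈ S} x^(stat σ), for S listed without repetition
genPoly : {A : Set} → (A → ℕ) → List A → Poly
genPoly stat S k = length (filter (λ σ → stat σ ≟ k) S)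

module _ {A : Set} {_≺_ : Rel A 0ℓ} (_≺?_ : Decidable _≺_) where

  descents : List A → ℕ
  descents []          = 0
  descents (_ ∷ [])    = 0
  descents (a ∷ b ∷ w) = (if does (b ≺? a) then 1 else 0) + descents (b ∷ w)

des : List ℕ → ℕ
des = descents _<?_

desB : List ℤ → ℕ
desB σ = descents ℤ._<?_ (0ℤ ∷ σ)

[1⋯_] : ℕ → List ℕ
[1⋯ n ] = map suc (upTo n)

-- 1,1,2,2,…,n,n
doubled : ℕ → List ℕ
doubled n = concatMap (λ i → i ∷ i ∷ []) [1⋯ n ]

-- 1,1,2,2,…,n,n,n+1
doubled⁺ : ℕ → List ℕ
doubled⁺ n = doubled n ++ [ suc n ]

IsC± : ℕ → Pred (List ℤ) 0ℓ
IsC± n σ = map ∣_∣ σ ↭ doubled n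

IsD : ℕ → Pred (List ℕ) 0ℓ
IsD n σ = σ ↭ doubled⁺ n

IsD± : ℕ → Pred (List ℤ) 0ℓ
IsD± n σ = map ∣_∣ σ ↭ doubled⁺ n × + suc n ∈ σ

_↭?_ : Decidable (_↭_ {A = ℕ})
[]       ↭? []       = yes ↭-refl
[]       ↭? (_ ∷ _)  = no (¬x∷xs↭[] ∘ ↭-sym)
(x ∷ xs) ↭? ys with DecMembership._∈?_ _≟_ x ys
... | no  x∉ys = no λ p → x∉ys (∈-resp-↭ p (here refl))
... | yes x∈ys with ∈-∃++ x∈ys
...   | as , bs , refl = map′
        (λ p → ↭-trans (prep x p) (↭-sym (shift x as bs)))
        (λ p → drop-∷ (↭-trans p (shift x as bs)))
        (xs ↭? (as ++ bs))

IsC±? : ∀ n → Decidable₁ (IsC± n)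
IsC±? n σ = map ∣_∣ σ ↭? doubled n

IsD? : ∀ n → Decidable₁ (IsD n)
IsD? n σ = σ ↭? doubled⁺ n

IsD±? : ∀ n → Decidable₁ (IsD± n)
IsD±? n σ = (map ∣_∣ σ ↭? doubled⁺ n) ×-dec DecMembership._∈?_ ℤ._≟_ (+ suc n) σ

words : {A : Set} → List A → ℕ → List (List A)
words as zero    = [ [] ]
words as (suc m) = cartesianProductWith _∷_ as (words as m)

-- -1,…,-n,1,…,n
±[1⋯_] : ℕ → List ℤ
±[1⋯ n ] = map -[1+_] (upTo n) ++ map (λ i → + suc i) (upTo n)

-- That these lists contain each required word exactly once is shown by
-- `∈C±`, `∈D`, `∈D±` and `C±-unique`, `D-unique`, `D±-unique` below.
C± : ℕ → List (List ℤ)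
C± n = filter (IsC±? n) (words ±[1⋯ n ] (length (doubled n)))

D : ℕ → List (List ℕ)
D n = filter (IsD? n) (words [1⋯ suc n ] (length (doubled⁺ n)))

D± : ℕ → List (List ℤ)
D± n = filter (IsD±? n) (words ±[1⋯ suc n ] (length (doubled⁺ n)))

Q : ℕ → Poly
Q n = genPoly des (D n)

S : ℕ → Poly
S n = genPoly desB (C± n)

T : ℕ → Poly
T n = genPoly desB (D± n)

words-unique : {A : Set} {as : List A} → Unique as → ∀ m → Unique (words as m)
words-unique u zero    = [] ∷ []
words-unique u (suc m) =
  Unique.cartesianProductWith⁺ _∷_ ∷-injective u (words-unique u m)

words-complete : {A : Set} {as : List A} (w : List A) →
                 (∀ {a} → a ∈ w → a ∈ as) → w ∈ words as (length w)
words-complete []      _ = here refl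
words-complete (a ∷ w) h =
  ∈-cartesianProductWith⁺ _∷_ (h (here refl)) (words-complete w (h ∘ there))

[1⋯]-unique : ∀ n → Unique [1⋯ n ]
[1⋯]-unique n = Unique.map⁺ suc-injective (Unique.upTo⁺ n)

±[1⋯]-unique : ∀ n → Unique ±[1⋯ n ]
±[1⋯]-unique n = Unique.++⁺
  (Unique.map⁺ ℤ.-[1+-injective (Unique.upTo⁺ n))
  (Unique.map⁺ (suc-injective ∘ ℤ.+-injective) (Unique.upTo⁺ n))
  λ (p , q) → disjoint (∈-map⁻ _ p) (∈-map⁻ _ q)
  where
  disjoint : ∀ {z} → ∃ (λ i → i ∈ upTo n × z ≡ -[1+ i ]) →
             ¬ ∃ (λ i → i ∈ upTo n × z ≡ + suc i)
  disjoint (_ , _ , refl) (_ , _ , ())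

∣∣∈⇒∈± : ∀ n z → ∣ z ∣ ∈ [1⋯ n ] → z ∈ ±[1⋯ n ]
∣∣∈⇒∈± n z p with ∈-map⁻ suc p
∣∣∈⇒∈± n (+ _)    p | i , q , refl = ∈-++⁺ʳ _ (∈-map⁺ (λ i → + suc i) q)
∣∣∈⇒∈± n -[1+ _ ] p | i , q , refl = ∈-++⁺ˡ (∈-map⁺ -[1+_] q)

∈-doubled : ∀ n {i} → i ∈ doubled n → i ∈ [1⋯ n ]
∈-doubled n p = go [1⋯ n ] p
  where
  go : ∀ xs {i} → i ∈ concatMap (λ i → i ∷ i ∷ []) xs → i ∈ xs
  go (x ∷ xs) (here e)          = here e
  go (x ∷ xs) (there (here e))  = here e
  go (x ∷ xs) (there (there p)) = there (go xs p)

∈-doubled⁺ : ∀ n {i} → i ∈ doubled⁺ n → i ∈ [1⋯ suc n ]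
∈-doubled⁺ n p with ∈-++⁻ (doubled n) p
... | inj₂ (here refl) = ∈-map⁺ suc (∈-upTo⁺ (n<1+n n))
... | inj₁ q with ∈-map⁻ suc (∈-doubled n q)
...   | i , r , refl = ∈-map⁺ suc (∈-upTo⁺ (m<n⇒m<1+n (∈-upTo⁻ r)))

signed-complete : ∀ n {M} → (∀ {i} → i ∈ M → i ∈ [1⋯ n ]) →
                  ∀ σ → map ∣_∣ σ ↭ M → σ ∈ words ±[1⋯ n ] (length M)
signed-complete n h σ p =
  subst (λ m → σ ∈ words ±[1⋯ n ] m)
    (trans (sym (length-map ∣_∣ σ)) (↭-length p))
    (words-complete σ λ {z} z∈σ → ∣∣∈⇒∈± n z (h (∈-resp-↭ p (∈-map⁺ ∣_∣ z∈σ))))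

∈C± : ∀ n σ → σ ∈ C± n ⇔ IsC± n σ
∈C± n σ = mk⇔
  (λ p → proj₂ (∈-filter⁻ (IsC±? n) {xs = words ±[1⋯ n ] (length (doubled n))} p))
  (λ p → ∈-filter⁺ (IsC±? n) (signed-complete n (∈-doubled n) σ p) p)

∈D : ∀ n σ → σ ∈ D n ⇔ IsD n σ
∈D n σ = mk⇔
  (λ p → proj₂ (∈-filter⁻ (IsD? n) {xs = words [1⋯ suc n ] (length (doubled⁺ n))} p))
  (λ p → ∈-filter⁺ (IsD? n)
    (subst (λ m → σ ∈ words [1⋯ suc n ] m) (↭-length p)
      (words-complete σ (∈-doubled⁺ n ∘ ∈-resp-↭ p))) p)

∈D± : ∀ n σ → σ ∈ D± n ⇔ IsD± n σ
∈D± n σ = mk⇔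
  (λ p → proj₂ (∈-filter⁻ (IsD±? n) {xs = words ±[1⋯ suc n ] (length (doubled⁺ n))} p))
  (λ p → ∈-filter⁺ (IsD±? n) (signed-complete (suc n) (∈-doubled⁺ n) σ (proj₁ p)) p)

C±-unique : ∀ n → Unique (C± n)
C±-unique n = Unique.filter⁺ (IsC±? n) (words-unique (±[1⋯]-unique n) (length (doubled n)))

D-unique : ∀ n → Unique (D n)
D-unique n = Unique.filter⁺ (IsD? n) (words-unique ([1⋯]-unique (suc n)) (length (doubled⁺ n)))

D±-unique : ∀ n → Unique (D± n)
D±-unique n = Unique.filter⁺ (IsD±? n) (words-unique (±[1⋯]-unique (suc n)) (length (doubled⁺ n)))

{-# OPTIONS --safe #-}

-- Call f of degree d alternatingly increasing if f₀ ≤ f_d ≤ f₁ ≤ f_{d-1} ≤ ⋯; such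
-- an f is unimodal with mode ⌊(d+1)/2⌋.  This property passes from f to
--   g_j = (α j + β) f_j + (α (d + 1 - j) + δ) f_{j-1}
-- whenever β ≤ δ ≤ α + β.  Let R_n be the descent polynomial of the rearrangements
-- of 1,1,…,n,n.  Inserting the largest letters into a word and counting the new
-- descents gives recurrences of this form, with (α, β, δ) equal to
--   (1,1,2) for R_n → Q_n,        (1,2,1) for Q_n → 2 R_{n+1},
--   (2,1,3) for T_n → S_{n+1},    (1,1,1) for S_n → T_n.
-- The second one violates β ≤ δ, but R_{n+1} is palindromic, which makes up for it.
module Submission where

open import Defs
open import Data.Bool using (true; false; if_then_else_)
open import Data.Integer as ℤ using (ℤ; -[1+_]; 0ℤ; ∣_∣; +<+; -<+; -<-)
import Data.Integer.Properties as ℤ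
open import Data.List using (List; []; _∷_; [_]; _++_; map; length; filter; replicate; concatMap; upTo; cartesianProductWith)
open import Data.List.Membership.Propositional using (_∈_; _∉_; find; lose)
open import Data.List.Membership.Propositional.Properties using (∈-map⁺; ∈-map⁻; ∈-++⁺ˡ; ∈-++⁺ʳ; ∈-++⁻; ∈-∃++; ∈-upTo⁻; ∈-concatMap⁺; ∈-concatMap⁻; ∈-cartesianProductWith⁺; ∈-cartesianProductWith⁻)
open import Data.List.Membership.Propositional.Properties.WithK using (unique∧set⇒bag)
open import Data.List.Properties using (map-++; map-∘; map-id; length-map; concatMap-++; upTo-∷ʳ; filter-accept; filter-reject; filter-all; ∷-injective; ∷-injectiveʳ)
open import Data.List.Relation.Binary.BagAndSetEquality using (∼bag⇒↭)
open import Data.List.Relation.Binary.Permutation.Propositional using (_↭_; ↭-refl; ↭-sym; ↭-trans; ↭-reflexive; prep)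
open import Data.List.Relation.Binary.Permutation.Propositional.Properties using (shift; drop-∷; ∈-resp-↭; map⁺; ++⁺ˡ; ++-comm; ↭-length; ↭-empty-inv)
open import Data.List.Relation.Unary.All as All using (All; []; _∷_)
open import Data.List.Relation.Unary.AllPairs using ([]; _∷_)
open import Data.List.Relation.Unary.Any using (here; there)
open import Data.List.Relation.Unary.Unique.Propositional using (Unique)
import Data.List.Relation.Unary.Unique.Propositional.Properties as Unique
open import Data.Nat
open import Data.Nat.ListAction using (sum)
open import Data.Nat.ListAction.Properties using (sum-++; sum-↭)
open import Data.Nat.Properties
open import Data.Nat.Tactic.RingSolver using (solve-∀)
open import Data.Product using (_×_; _,_; proj₁; proj₂; ∃; ∃₂)
open import Data.Sum using (inj₁; inj₂)
open import Function using (_∘_; id; _⇔_; mk⇔; Equivalence)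
open import Level using (0ℓ)
open import Relation.Binary using (Rel; Decidable; IsStrictPartialOrder)
open import Relation.Binary.PropositionalEquality hiding ([_])
open import Relation.Nullary using (¬_; ¬?; does; yes; no)
open import Relation.Nullary.Decidable using (dec-true; dec-false)

-- Unimodality alone also survives such a recurrence, because g_{j+1} - g_j is a nonnegative
-- combination of f_{j+1} - f_j and f_j - f_{j-1}; but it leaves open whether the mode stays or
-- moves by one. Comparing mirror coefficients decides this. The constants come from counting slots.
-- Let w have N letters and let 0w have k descents. A new largest letter keeps the descent number in
-- the k descents and at the end, and raises it in the other N - k gaps, so α = β = 1 and δ = N - d.
-- A second copy also keeps it immediately before the first copy, which makes k + 2 out of k + 1. A
-- letter that may be largest or smallest acts alike for both choices in every gap and oppositely at
-- the end, so 2k + 1 results keep the number. The last rule presupposes words without n + 1,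
-- whereas those counted by T_n contain it. Hence T_n → S_{n+1} is not a second insertion: both
-- sides are summed over the words of S_n, and the sum over each fibre factors.

-- The alternating order of coefficients and unimodality

Rising : ℕ → Poly → Set
Rising d f = ∀ i j → i + j ≡ d → i ≤ j → f i ≤ f j

Falling : ℕ → Poly → Set
Falling d f = ∀ i j → i + j ≡ suc d → i ≤ j → f j ≤ f i

-- f₀ ≤ f_d ≤ f₁ ≤ f_{d-1} ≤ ⋯
record AlternatinglyIncreasing (d : ℕ) (f : Poly) : Set where
  constructor mkAlt
  field
    degree  : HasDegree f d
    rising  : Rising d f
    falling : Falling d f

open AlternatinglyIncreasing

-- Neighbours are compared through a mirror index: f_i ≤ f_{d-i} ≤ f_{i+1} below the middle, and
-- f_{i+1} ≤ f_{d-i} ≤ f_i from the middle on.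
alternatinglyIncreasing⇒unimodal : ∀ {d f} → AlternatinglyIncreasing d f →
                                   UnimodalWithModeInTheMiddle f d
alternatinglyIncreasing⇒unimodal {d} {f} alt =
  degree alt , subst (UnimodalWithMode f d ∘ ⌊_/2⌋) (+-comm 1 d) (⌈n/2⌉≤n d , up , down)
  where
  open ≤-Reasoning

  up : ∀ i → i < ⌈ d /2⌉ → f i ≤ f (suc i)
  up i i<m = ≤-trans
    (rising alt i (d ∸ i) (m+[n∸m]≡n i≤d) (<⇒≤ i<d∸i))
    (falling alt (suc i) (d ∸ i) (cong suc (m+[n∸m]≡n i≤d)) i<d∸i)
    where
    2i<d : i + suc i ≤ d
    2i<d = begin
      i + suc i             ≤⟨ +-mono-≤ (s≤s⁻¹ (≤-trans i<m (⌊n/2⌋-mono (n≤1+n (suc d))))) i<m ⟩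
      ⌊ d /2⌋ + ⌈ d /2⌉     ≡⟨ ⌊n/2⌋+⌈n/2⌉≡n d ⟩
      d                     ∎
    i≤d : i ≤ d
    i≤d = m+n≤o⇒m≤o i 2i<d
    i<d∸i : i < d ∸ i
    i<d∸i = m+n≤o⇒m≤o∸n (suc i) (subst (_≤ d) (+-comm i (suc i)) 2i<d)

  down : ∀ i → ⌈ d /2⌉ ≤ i → i < d → f (suc i) ≤ f i
  down i m≤i i<d = ≤-trans
    (falling alt (d ∸ i) (suc i) (trans (+-suc (d ∸ i) i) (cong suc (m∸n+n≡m (<⇒≤ i<d)))) (m≤n⇒m≤1+n d∸i≤i))
    (rising alt (d ∸ i) i (m∸n+n≡m (<⇒≤ i<d)) d∸i≤i)
    where
    d∸i≤i : d ∸ i ≤ i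
    d∸i≤i = m≤n+o⇒m∸n≤o d i (begin
      d                     ≡⟨ ⌊n/2⌋+⌈n/2⌉≡n d ⟨
      ⌊ d /2⌋ + ⌈ d /2⌉     ≤⟨ +-mono-≤ (≤-trans (⌊n/2⌋≤⌈n/2⌉ d) m≤i) m≤i ⟩
      i + i                 ∎)

-- Recurrences that preserve the alternating order

shiftUp : Poly → Poly
shiftUp f zero    = 0
shiftUp f (suc i) = f i

-- With j + j′ = d + 1 in place of truncated subtraction, the second coefficient
-- is α (d + 1 - j) + δ.
record Step (α β δ d : ℕ) (f g : Poly) : Set where
  field
    formula   : ∀ j j′ → j + j′ ≡ suc d → g j ≡ (α * j + β) * f j + (α * j′ + δ) * shiftUp f j
    vanishing : ∀ j → suc d < j → g j ≡ 0

open Step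

module _ {α β δ d : ℕ} {f g : Poly} (step : Step α β δ d f g) (alt : AlternatinglyIncreasing d f) where

  step-degree : 1 ≤ δ → HasDegree g (suc d)
  step-degree 1≤δ = (λ g≡0 → proj₁ (degree alt) (n≤0⇒n≡0 (begin
      f d                                                  ≤⟨ m≤n*m (f d) δ {{>-nonZero 1≤δ}} ⟩
      δ * f d                                              ≤⟨ *-monoˡ-≤ (f d) (m≤n+m δ (α * 0)) ⟩
      (α * 0 + δ) * f d                                    ≤⟨ m≤n+m _ ((α * suc d + β) * f (suc d)) ⟩
      (α * suc d + β) * f (suc d) + (α * 0 + δ) * f d      ≡⟨ formula step (suc d) 0 (+-identityʳ (suc d)) ⟨
      g (suc d)                                            ≡⟨ g≡0 ⟩
      0                                                    ∎))) , vanishing step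
    where open ≤-Reasoning

  -- For i + j = d + 1 the terms are paired crosswise, f_i with f_{j-1} and f_{i-1} with f_j, since
  -- both pairs have index sum d. The weights in a pair agree up to ε = δ - β, and the ε extra
  -- copies of f_{i-1} are absorbed by those of f_{j-1}.
  step-rising : β ≤ δ → Rising (suc d) g
  step-rising β≤δ i j i+j≡1+d i≤j with m≤n⇒m<n∨m≡n i≤j
  ... | inj₂ refl = ≤-refl
  step-rising β≤δ i (suc j) i+j≡1+d _ | inj₁ (s≤s i≤j) with m≤n⇒∃[o]m+o≡n β≤δ
  ... | ε , refl = begin
    g i
      ≡⟨ formula step i (suc j) i+j≡1+d ⟩
    (α * i + β) * f i + (α * suc j + (β + ε)) * fi⁻
      ≡⟨ split (α * i + β) (α * suc j) β ε (f i) fi⁻ ⟩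
    (α * i + β) * f i + ε * fi⁻ + (α * suc j + β) * fi⁻
      ≤⟨ +-mono-≤ (+-mono-≤ (*-monoʳ-≤ (α * i + β) fi≤fj) (*-monoʳ-≤ ε fi⁻≤fj))
                  (*-monoʳ-≤ (α * suc j + β) fi⁻≤fj⁺) ⟩
    (α * i + β) * f j + ε * f j + (α * suc j + β) * f (suc j)
      ≡⟨ merge (α * i) β ε (f j) _ ⟩
    (α * suc j + β) * f (suc j) + (α * i + (β + ε)) * f j
      ≡⟨ formula step (suc j) i (trans (+-comm (suc j) i) i+j≡1+d) ⟨
    g (suc j) ∎
    where
    open ≤-Reasoning
    fi⁻ = shiftUp f i
    i+j≡d : i + j ≡ d
    i+j≡d = suc-injective (trans (sym (+-suc i j)) i+j≡1+d)
    fi≤fj : f i ≤ f j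
    fi≤fj = rising alt i j i+j≡d i≤j
    below : ∀ i → i + j ≡ d → i ≤ j → shiftUp f i ≤ f (suc j)
    below zero    _  _   = z≤n
    below (suc i) eq i<j = rising alt i (suc j) (trans (+-suc i j) eq) (≤-trans (<⇒≤ i<j) (n≤1+n j))
    fi⁻≤fj⁺ : fi⁻ ≤ f (suc j)
    fi⁻≤fj⁺ = below i i+j≡d i≤j
    fi⁻≤fj : fi⁻ ≤ f j
    fi⁻≤fj = ≤-trans fi⁻≤fj⁺ (≤-trans (falling alt i (suc j) i+j≡1+d (m≤n⇒m≤1+n i≤j)) fi≤fj)
    split : ∀ a b c e x y → a * x + (b + (c + e)) * y ≡ a * x + e * y + (b + c) * y
    split = solve-∀
    merge : ∀ a b e x y → (a + b) * x + e * x + y ≡ y + (a + (b + e)) * x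
    merge = solve-∀

  -- The same crosswise pairing, now with index sums d + 1. Here the surplus is ε = α + β - δ: the ε
  -- extra copies of the outermost coefficient on the right are absorbed by those of its counterpart
  -- nearer the middle on the left.
  step-falling : δ ≤ α + β → Falling (suc d) g
  step-falling δ≤α+β i j i+j≡2+d i≤j with m≤n⇒m<n∨m≡n i≤j
  ... | inj₂ refl = ≤-refl
  step-falling δ≤α+β zero j refl _ | inj₁ _ rewrite vanishing step j ≤-refl = z≤n
  step-falling δ≤α+β (suc i) (suc j) i+j≡2+d _ | inj₁ (s≤s i<j) with m≤n⇒∃[o]m+o≡n δ≤α+β
  ... | ε , δ+ε≡α+β = begin
    g (suc j)
      ≡⟨ formula step (suc j) i (trans (cong suc (+-comm j i)) i+j≡1+d′) ⟩
    (α * suc j + β) * f (suc j) + (α * i + δ) * f j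
      ≡⟨ cong (λ c → c * f (suc j) + (α * i + δ) * f j) (expand j) ⟩
    (α * j + δ + ε) * f (suc j) + (α * i + δ) * f j
      ≡⟨ split (α * j + δ) ε (α * i + δ) (f (suc j)) (f j) ⟩
    (α * i + δ) * f j + ε * f (suc j) + (α * j + δ) * f (suc j)
      ≤⟨ +-mono-≤ (+-mono-≤ (*-monoʳ-≤ (α * i + δ) fj≤fi⁺) (*-monoʳ-≤ ε (≤-trans fj⁺≤fi (≤-trans fi≤fj fj≤fi⁺))))
                  (*-monoʳ-≤ (α * j + δ) fj⁺≤fi) ⟩
    (α * i + δ) * f (suc i) + ε * f (suc i) + (α * j + δ) * f i
      ≡⟨ cong (_+ (α * j + δ) * f i) (*-distribʳ-+ (f (suc i)) (α * i + δ) ε) ⟨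
    (α * i + δ + ε) * f (suc i) + (α * j + δ) * f i
      ≡⟨ cong (λ c → c * f (suc i) + (α * j + δ) * f i) (expand i) ⟨
    (α * suc i + β) * f (suc i) + (α * j + δ) * f i
      ≡⟨ formula step (suc i) j i+j≡1+d′ ⟨
    g (suc i) ∎
    where
    open ≤-Reasoning
    i+j≡1+d : i + suc j ≡ suc d
    i+j≡1+d = suc-injective i+j≡2+d
    i+j≡1+d′ : suc i + j ≡ suc d
    i+j≡1+d′ = trans (sym (+-suc i j)) i+j≡1+d
    i≤j′ : i ≤ j
    i≤j′ = <⇒≤ i<j
    fj≤fi⁺ : f j ≤ f (suc i)
    fj≤fi⁺ = falling alt (suc i) j i+j≡1+d′ i<j
    fj⁺≤fi : f (suc j) ≤ f i
    fj⁺≤fi = falling alt i (suc j) i+j≡1+d (m≤n⇒m≤1+n i≤j′)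
    fi≤fj : f i ≤ f j
    fi≤fj = rising alt i j (suc-injective i+j≡1+d′) i≤j′
    expand : ∀ k → α * suc k + β ≡ α * k + δ + ε
    expand k = trans (rearrange α k β) (trans (cong (α * k +_) (sym δ+ε≡α+β)) (sym (+-assoc (α * k) δ ε)))
      where
      rearrange : ∀ a k b → a * suc k + b ≡ a * k + (a + b)
      rearrange = solve-∀
    split : ∀ a e b x y → (a + e) * x + b * y ≡ b * y + e * x + a * x
    split = solve-∀

  step-alternatinglyIncreasing : 1 ≤ δ → β ≤ δ → δ ≤ α + β → AlternatinglyIncreasing (suc d) g
  step-alternatinglyIncreasing 1≤δ β≤δ δ≤α+β =
    mkAlt (step-degree 1≤δ) (step-rising β≤δ) (step-falling δ≤α+β)

-- Palindromic polynomials and two steps combined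

Symmetric : ℕ → Poly → Set
Symmetric d f = ∀ i j → i + j ≡ d → f i ≡ f j

-- The two zeros put in front mirror the zeros at d + 3 and d + 4. Reflection thus also covers the
-- out-of-range coefficients that occur in `two-steps`.
shiftUp²-symmetric : ∀ {d f} → Symmetric d f → (∀ i → d < i → f i ≡ 0) → Symmetric (4 + d) (shiftUp (shiftUp f))
shiftUp²-symmetric {d} {f} sy supp = go
  where
  e = shiftUp (shiftUp f)
  low : ∀ i j → i ≤ 1 → i + j ≡ 4 + d → e i ≡ e j
  low zero       _ _ refl = sym (supp (2 + d) (s≤s (n≤1+n d)))
  low (suc zero) _ _ refl = sym (supp (1 + d) ≤-refl)
  low (suc (suc _)) _ (s≤s ()) _
  go : Symmetric (4 + d) e
  go zero          j             eq = low 0 j z≤n eq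
  go (suc zero)    j             eq = low 1 j ≤-refl eq
  go i@(suc (suc _)) zero        eq = sym (low 0 i z≤n (trans (+-comm 0 i) eq))
  go i@(suc (suc _)) (suc zero)  eq = sym (low 1 i ≤-refl (trans (+-comm 1 i) eq))
  go (suc (suc i)) (suc (suc j)) eq = sy i j (+-cancelˡ-≡ 4 _ _ (trans (rearrange i j) eq))
    where
    rearrange : ∀ i j → 4 + (i + j) ≡ 2 + i + (2 + j)
    rearrange = solve-∀

-- Here β > δ in the second step, so step-rising does not apply to it; instead the
-- composite recurrence is invariant under j ↦ d + 2 - j.
module _ {d : ℕ} {c q c′ : Poly}
         (step₁ : Step 1 1 2 d c q)
         (step₂ : Step 1 2 1 (suc d) q (λ j → 2 * c′ j))
         (supp : ∀ i → d < i → c i ≡ 0) where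

  private
    e = shiftUp (shiftUp c)

  -- The three values of `e` are c_i, c_{i-1}, c_{i-2}. Exchanging i and j swaps the outer weights;
  -- the middle one, (i + 2)(j + 1) + (j + 1) i, equals 2 (i + 1)(j + 1) and is fixed.
  two-steps : ∀ i j → i + j ≡ 2 + d →
              2 * c′ i ≡ (i + 2) * (i + 1) * e (2 + i) + 2 * ((i + 1) * (j + 1)) * e (1 + i)
                         + (j + 1) * (j + 2) * e i
  two-steps zero j refl = begin
    2 * c′ 0                                ≡⟨ formula step₂ 0 j refl ⟩
    2 * q 0 + (1 * j + 1) * 0               ≡⟨ cong (λ x → 2 * x + (1 * j + 1) * 0) (formula step₁ 0 (1 + d) refl) ⟩
    2 * (1 * c 0 + (1 * (1 + d) + 2) * 0) + (1 * j + 1) * 0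
                                            ≡⟨ poly d j (c 0) ⟩
    2 * c 0 + 2 * (1 * (j + 1)) * 0 + (j + 1) * (j + 2) * 0 ∎
    where
    open ≡-Reasoning
    poly : ∀ d j x → 2 * (1 * x + (1 * (1 + d) + 2) * 0) + (1 * j + 1) * 0
                     ≡ 2 * x + 2 * (1 * (j + 1)) * 0 + (j + 1) * (j + 2) * 0
    poly = solve-∀
  -- Here `suc i` is d + 2, outside the range of the formula for `q`, so q_{d+2} = 0 takes its
  -- place, together with c_{d+1} = c_{d+2} = 0.
  two-steps (suc i) zero i+0≡2+d = begin
    2 * c′ (suc i)                          ≡⟨ formula step₂ (suc i) 0 i+0≡2+d ⟩
    (1 * suc i + 2) * q (suc i) + 1 * q i   ≡⟨ cong₂ (λ x y → (1 * suc i + 2) * x + 1 * y) q1+i≡0 (formula step₁ i 0 i+0≡1+d) ⟩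
    (1 * suc i + 2) * 0 + 1 * ((1 * i + 1) * c i + 2 * shiftUp c i)
                                            ≡⟨ cong (λ x → (1 * suc i + 2) * 0 + 1 * ((1 * i + 1) * x + 2 * shiftUp c i)) ci≡0 ⟩
    (1 * suc i + 2) * 0 + 1 * ((1 * i + 1) * 0 + 2 * shiftUp c i)
                                            ≡⟨ poly i (shiftUp c i) ⟩
    (suc i + 2) * (suc i + 1) * 0 + 2 * ((suc i + 1) * 1) * 0 + 1 * 2 * shiftUp c i
                                            ≡⟨ cong₂ (λ x y → (suc i + 2) * (suc i + 1) * x + 2 * ((suc i + 1) * 1) * y + 1 * 2 * shiftUp c i)
                                                 (sym c1+i≡0) (sym ci≡0) ⟩
    (suc i + 2) * (suc i + 1) * c (suc i) + 2 * ((suc i + 1) * 1) * c i + 1 * 2 * shiftUp c i ∎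
    where
    open ≡-Reasoning
    i+0≡1+d : i + 0 ≡ suc d
    i+0≡1+d = suc-injective i+0≡2+d
    i≡1+d : i ≡ suc d
    i≡1+d = trans (sym (+-identityʳ i)) i+0≡1+d
    q1+i≡0 : q (suc i) ≡ 0
    q1+i≡0 = vanishing step₁ (suc i) (s≤s (≤-reflexive (sym i≡1+d)))
    ci≡0 : c i ≡ 0
    ci≡0 = supp i (≤-reflexive (sym i≡1+d))
    c1+i≡0 : c (suc i) ≡ 0
    c1+i≡0 = supp (suc i) (m≤n⇒m≤1+n (≤-reflexive (sym i≡1+d)))
    poly : ∀ i x → (1 * suc i + 2) * 0 + 1 * ((1 * i + 1) * 0 + 2 * x)
                   ≡ (suc i + 2) * (suc i + 1) * 0 + 2 * ((suc i + 1) * 1) * 0 + 1 * 2 * x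
    poly = solve-∀
  two-steps (suc i) (suc j) eq = begin
    2 * c′ (suc i)                          ≡⟨ formula step₂ (suc i) (suc j) eq ⟩
    (1 * suc i + 2) * q (suc i) + (1 * suc j + 1) * q i
                                            ≡⟨ cong₂ (λ x y → (1 * suc i + 2) * x + (1 * suc j + 1) * y)
                                                 (formula step₁ (suc i) j (trans (sym (+-suc i j)) (suc-injective eq)))
                                                 (formula step₁ i (suc j) (suc-injective eq)) ⟩
    (1 * suc i + 2) * ((1 * suc i + 1) * c (suc i) + (1 * j + 2) * c i)
      + (1 * suc j + 1) * ((1 * i + 1) * c i + (1 * suc j + 2) * shiftUp c i)
                                            ≡⟨ poly i j (c (suc i)) (c i) (shiftUp c i) ⟩
    (suc i + 2) * (suc i + 1) * c (suc i) + 2 * ((suc i + 1) * (suc j + 1)) * c i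
      + (suc j + 1) * (suc j + 2) * shiftUp c i ∎
    where
    open ≡-Reasoning
    poly : ∀ i j x y z → (1 * suc i + 2) * ((1 * suc i + 1) * x + (1 * j + 2) * y)
                         + (1 * suc j + 1) * ((1 * i + 1) * y + (1 * suc j + 2) * z)
                         ≡ (suc i + 2) * (suc i + 1) * x + 2 * ((suc i + 1) * (suc j + 1)) * y
                           + (suc j + 1) * (suc j + 2) * z
    poly = solve-∀

  two-steps-symmetric : Symmetric d c → Symmetric (2 + d) c′
  two-steps-symmetric sy i j i+j≡2+d = *-cancelˡ-≡ _ _ 2 (begin
    2 * c′ i  ≡⟨ two-steps i j i+j≡2+d ⟩
    (i + 2) * (i + 1) * e (2 + i) + 2 * ((i + 1) * (j + 1)) * e (1 + i) + (j + 1) * (j + 2) * e i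
              ≡⟨ cong₂ _+_ (cong₂ (λ x y → (i + 2) * (i + 1) * x + 2 * ((i + 1) * (j + 1)) * y)
                   (e-sym (2 + i) j (cong (2 +_) i+j≡2+d))
                   (e-sym (1 + i) (1 + j) (trans (cong suc (+-suc i j)) (cong (2 +_) i+j≡2+d))))
                   (cong ((j + 1) * (j + 2) *_) (e-sym i (2 + j)
                     (trans (trans (+-suc i (suc j)) (cong suc (+-suc i j))) (cong (2 +_) i+j≡2+d)))) ⟩
    (i + 2) * (i + 1) * e j + 2 * ((i + 1) * (j + 1)) * e (1 + j) + (j + 1) * (j + 2) * e (2 + j)
              ≡⟨ poly i j (e j) (e (1 + j)) (e (2 + j)) ⟩
    (j + 2) * (j + 1) * e (2 + j) + 2 * ((j + 1) * (i + 1)) * e (1 + j) + (i + 1) * (i + 2) * e j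
              ≡⟨ two-steps j i (trans (+-comm j i) i+j≡2+d) ⟨
    2 * c′ j  ∎)
    where
    open ≡-Reasoning
    e-sym : Symmetric (4 + d) e
    e-sym = shiftUp²-symmetric sy supp
    poly : ∀ i j x y z → (i + 2) * (i + 1) * x + 2 * ((i + 1) * (j + 1)) * y + (j + 1) * (j + 2) * z
                         ≡ (j + 2) * (j + 1) * z + 2 * ((j + 1) * (i + 1)) * y + (i + 1) * (i + 2) * x
    poly = solve-∀

  -- Symmetry gives the rising half with equality. The falling half and the degree still come from
  -- the second step, where δ ≤ α + β reads 1 ≤ 3, after cancelling the factor 2.
  two-steps-alternatinglyIncreasing : Symmetric d c → AlternatinglyIncreasing (suc d) q →
                                      AlternatinglyIncreasing (2 + d) c′
  two-steps-alternatinglyIncreasing sy alt = mkAlt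
    ((λ c′≡0 → proj₁ deg (cong (2 *_) c′≡0)) , λ i 2+d<i → m+n≡0⇒m≡0 (c′ i) (proj₂ deg i 2+d<i))
    (λ i j i+j≡2+d _ → ≤-reflexive (two-steps-symmetric sy i j i+j≡2+d))
    (λ i j eq i≤j → *-cancelˡ-≤ 2 (step-falling step₂ alt (s≤s z≤n) i j eq i≤j))
    where
    deg : HasDegree (λ j → 2 * c′ j) (2 + d)
    deg = step-degree step₂ alt ≤-refl

-- Sums over insertions

∑ : {B : Set} → (B → ℕ) → List B → ℕ
∑ F xs = sum (map F xs)

∑-++ : {B : Set} (F : B → ℕ) (xs ys : List B) → ∑ F (xs ++ ys) ≡ ∑ F xs + ∑ F ys
∑-++ F xs ys = trans (cong sum (map-++ F xs ys)) (sum-++ (map F xs) (map F ys))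

∑-map : {B C : Set} (F : C → ℕ) (g : B → C) (xs : List B) → ∑ F (map g xs) ≡ ∑ (F ∘ g) xs
∑-map F g xs = cong sum (sym (map-∘ xs))

∑-cartesianProductWith-∷ : {A : Set} (F : List A → ℕ) (L : List A) (ws : List (List A)) →
  ∑ F (cartesianProductWith _∷_ L ws) ≡ ∑ (λ x → ∑ (F ∘ (x ∷_)) ws) L
∑-cartesianProductWith-∷ F []      ws = refl
∑-cartesianProductWith-∷ F (x ∷ L) ws = trans (∑-++ F (map (x ∷_) ws) _)
  (cong₂ _+_ (∑-map F (x ∷_) ws) (∑-cartesianProductWith-∷ F L ws))

module _ {B : Set} where

  ∑-↭ : (F : B → ℕ) {xs ys : List B} → xs ↭ ys → ∑ F xs ≡ ∑ F ys
  ∑-↭ F xs↭ys = sum-↭ (map⁺ F xs↭ys)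

  ∑-cong : {F G : B → ℕ} (xs : List B) → (∀ {x} → x ∈ xs → F x ≡ G x) → ∑ F xs ≡ ∑ G xs
  ∑-cong []       F≡G = refl
  ∑-cong (x ∷ xs) F≡G = cong₂ _+_ (F≡G (here refl)) (∑-cong xs (F≡G ∘ there))

  ∑-concatMap : {C : Set} (F : C → ℕ) (g : B → List C) (xs : List B) →
                ∑ F (concatMap g xs) ≡ ∑ (∑ F ∘ g) xs
  ∑-concatMap F g []       = refl
  ∑-concatMap F g (x ∷ xs) = trans (∑-++ F (g x) (concatMap g xs)) (cong (∑ F (g x) +_) (∑-concatMap F g xs))

  ∑-+ : (F G : B → ℕ) (xs : List B) → ∑ (λ x → F x + G x) xs ≡ ∑ F xs + ∑ G xs
  ∑-+ F G []       = refl
  ∑-+ F G (x ∷ xs) = trans (cong (F x + G x +_) (∑-+ F G xs)) (poly (F x) (G x) (∑ F xs) (∑ G xs))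
    where
    poly : ∀ a b c d → a + b + (c + d) ≡ a + c + (b + d)
    poly = solve-∀

  *-∑ : (c : ℕ) (F : B → ℕ) (xs : List B) → c * ∑ F xs ≡ ∑ (λ x → c * F x) xs
  *-∑ c F []       = *-zeroʳ c
  *-∑ c F (x ∷ xs) = trans (*-distribˡ-+ c (F x) (∑ F xs)) (cong (c * F x +_) (*-∑ c F xs))

-- The shuffles of `w` with the words of length `m` over `L`, split by whether the first letter is
-- new. Iterating one-letter insertion instead would list a word with two equal new letters twice.
insertions : {A : Set} → List A → ℕ → List A → List (List A)
insertions L zero    w       = [ w ]
insertions L (suc m) []      = cartesianProductWith _∷_ L (insertions L m [])
insertions L (suc m) (a ∷ w) =
  cartesianProductWith _∷_ L (insertions L m (a ∷ w)) ++ map (a ∷_) (insertions L (suc m) w)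

-- The binomial coefficient n choose 2.
triangle : ℕ → ℕ
triangle zero    = 0
triangle (suc n) = n + triangle n

2*triangle : ∀ n → 2 * triangle n ≡ n * (n ∸ 1)
2*triangle zero          = refl
2*triangle (suc zero)    = refl
2*triangle (suc (suc n)) = trans (*-distribˡ-+ 2 (suc n) (triangle (suc n)))
  (trans (cong (2 * suc n +_) (2*triangle (suc n))) (poly n))
  where
  poly : ∀ n → 2 * suc n + suc n * n ≡ suc (suc n) * suc n
  poly = solve-∀

module _ {A : Set} {_≺_ : Rel A 0ℓ} (_≺?_ : Decidable _≺_) (spo : IsStrictPartialOrder _≡_ _≺_) where

  open IsStrictPartialOrder spo using (irrefl; asym) renaming (trans to ≺-trans)

  fall : A → A → ℕ
  fall a b = if does (b ≺? a) then 1 else 0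

  -- Plateaus count as ascents, so every adjacent pair is either a descent or an ascent.
  ascents : List A → ℕ
  ascents []          = 0
  ascents (_ ∷ [])    = 0
  ascents (a ∷ b ∷ w) = (if does (b ≺? a) then 0 else 1) + ascents (b ∷ w)

  private
    dsc : A → List A → ℕ
    dsc a w = descents _≺?_ (a ∷ w)

    asc : A → List A → ℕ
    asc a w = ascents (a ∷ w)

  descents+ascents : ∀ a w → dsc a w + asc a w ≡ length w
  descents+ascents a []      = refl
  descents+ascents a (b ∷ w) with does (b ≺? a)
  ... | true  = cong suc (descents+ascents b w)
  ... | false = trans (+-suc _ _) (cong suc (descents+ascents b w))

  fall≡1 : ∀ {a b} → b ≺ a → fall a b ≡ 1
  fall≡1 {a} {b} b≺a rewrite dec-true (b ≺? a) b≺a = refl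

  fall≡0 : ∀ {a b} → ¬ b ≺ a → fall a b ≡ 0
  fall≡0 {a} {b} b⊀a rewrite dec-false (b ≺? a) b⊀a = refl

  -- Opaque, so that rewriting with the recursion equations below is not
  -- defeated by the normal form of the underlying sum.
  opaque

    ∑-ins : List A → ℕ → (ℕ → ℕ) → A → List A → ℕ
    ∑-ins L m F a w = ∑ (F ∘ dsc a) (insertions L m w)

    ∑-ins-def : ∀ L m F a w → ∑ (λ σ → F (descents _≺?_ (a ∷ σ))) (insertions L m w) ≡ ∑-ins L m F a w
    ∑-ins-def L m F a w = refl

    ∑-ins-zero : ∀ L F a w → ∑-ins L 0 F a w ≡ F (dsc a w)
    ∑-ins-zero L F a w = +-identityʳ _

    ∑-ins-[] : ∀ L m F a →
      ∑-ins L (suc m) F a [] ≡ ∑ (λ x → ∑-ins L m (F ∘ (fall a x +_)) x []) L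
    ∑-ins-[] L m F a = ∑-cartesianProductWith-∷ (F ∘ dsc a) L (insertions L m [])

    ∑-ins-∷ : ∀ L m F a b w →
      ∑-ins L (suc m) F a (b ∷ w)
        ≡ ∑ (λ x → ∑-ins L m (F ∘ (fall a x +_)) x (b ∷ w)) L + ∑-ins L (suc m) (F ∘ (fall a b +_)) b w
    ∑-ins-∷ L m F a b w = trans (∑-++ (F ∘ dsc a) (cartesianProductWith _∷_ L (insertions L m (b ∷ w))) _)
      (cong₂ _+_ (∑-cartesianProductWith-∷ (F ∘ dsc a) L (insertions L m (b ∷ w)))
                 (∑-map (F ∘ dsc a) (b ∷_) (insertions L (suc m) w)))

  module _ (t : A) where

    -- The end of the word accounts for the 1 in `suc k`. The weight `F` is arbitrary because the
    -- recursion hides the comparison of `a` with `b` inside it.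
    ∑-insert-max : ∀ F a w → All (_≺ t) (a ∷ w) → let k = dsc a w; l = asc a w in
      ∑-ins [ t ] 1 F a w ≡ suc k * F k + l * F (suc k)
    ∑-insert-max F a [] (a≺t ∷ [])
      rewrite ∑-ins-[] [ t ] 0 F a | ∑-ins-zero [ t ] (F ∘ (fall a t +_)) t []
            | fall≡0 (asym a≺t) = poly (F 0) (F 1)
      where
      poly : ∀ x y → x + 0 ≡ 1 * x + 0 * y
      poly = solve-∀
    ∑-insert-max F a (b ∷ w) (a≺t ∷ ≺t@(b≺t ∷ _))
      rewrite ∑-ins-∷ [ t ] 0 F a b w | ∑-ins-zero [ t ] (F ∘ (fall a t +_)) t (b ∷ w)
            | fall≡0 (asym a≺t) | fall≡1 b≺t
            | ∑-insert-max (F ∘ (fall a b +_)) b w ≺t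
      with does (b ≺? a)
    ... | true  = poly (dsc b w) (asc b w) (F (1 + dsc b w)) (F (2 + dsc b w))
      where
      poly : ∀ k l x y → x + 0 + (suc k * x + l * y) ≡ suc (suc k) * x + l * y
      poly = solve-∀
    ... | false = poly (dsc b w) (asc b w) (F (dsc b w)) (F (1 + dsc b w))
      where
      poly : ∀ k l x y → y + 0 + (suc k * x + l * y) ≡ suc k * x + suc l * y
      poly = solve-∀

    -- Two copies go into the k + 1 neutral slots, repetition allowed, in (k + 2 choose 2) ways. One
    -- new descent arises from an ascent together with a neutral slot, or from both copies in one
    -- ascent: (k + 1) l + l ways. Two new descents need two different ascents.
    ∑-insert-max² : ∀ F a w → All (_≺ t) (a ∷ w) → let k = dsc a w; l = asc a w in
      ∑-ins [ t ] 2 F a w ≡ triangle (2 + k) * F k + (2 + k) * l * F (suc k) + triangle l * F (2 + k)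
    ∑-insert-max² F a [] (a≺t ∷ [])
      rewrite ∑-ins-[] [ t ] 1 F a | ∑-ins-[] [ t ] 0 (F ∘ (fall a t +_)) t
            | ∑-ins-zero [ t ] (F ∘ (fall a t +_) ∘ (fall t t +_)) t []
            | fall≡0 (asym a≺t) | fall≡0 (irrefl {t} refl) = poly (F 0) (F 1) (F 2)
      where
      poly : ∀ x y z → x + 0 + 0 ≡ 1 * x + 2 * 0 * y + 0 * z
      poly = solve-∀
    ∑-insert-max² F a (b ∷ w) (a≺t ∷ ≺t@(b≺t ∷ _))
      rewrite ∑-ins-∷ [ t ] 1 F a b w | ∑-ins-∷ [ t ] 0 (F ∘ (fall a t +_)) t b w
            | ∑-ins-zero [ t ] (F ∘ (fall a t +_) ∘ (fall t t +_)) t (b ∷ w)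
            | fall≡0 (asym a≺t) | fall≡0 (irrefl {t} refl) | fall≡1 b≺t
            | ∑-insert-max (F ∘ suc) b w ≺t
            | ∑-insert-max² (F ∘ (fall a b +_)) b w ≺t
      with does (b ≺? a)
    ... | true  = poly (dsc b w) (asc b w) (triangle (dsc b w)) (triangle (asc b w))
                    (F (1 + dsc b w)) (F (2 + dsc b w)) (F (3 + dsc b w))
      where
      poly : ∀ k l p q x y z →
        x + 0 + (suc k * x + l * y) + 0 + ((1 + k + (k + p)) * x + (2 + k) * l * y + q * z)
          ≡ (2 + k + (1 + k + (k + p))) * x + (3 + k) * l * y + q * z
      poly = solve-∀
    ... | false = poly (dsc b w) (asc b w) (triangle (2 + dsc b w)) (triangle (asc b w))
                    (F (dsc b w)) (F (1 + dsc b w)) (F (2 + dsc b w))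
      where
      poly : ∀ k l p q x y z →
        y + 0 + (suc k * y + l * z) + 0 + (p * x + (2 + k) * l * y + q * z)
          ≡ p * x + (2 + k) * suc l * y + (l + q) * z
      poly = solve-∀

    module _ (u : A) where

      private
        L : List A
        L = t ∷ u ∷ []

      -- In a descent either letter keeps the number, in an ascent either raises it; at the end `t`
      -- keeps it and `u` raises it.
      ∑-insert-extremes : ∀ F a w → All (_≺ t) (a ∷ w) → All (u ≺_) (a ∷ w) → let k = dsc a w; l = asc a w in
        ∑-ins L 1 F a w ≡ (2 * k + 1) * F k + (2 * l + 1) * F (suc k)
      ∑-insert-extremes F a [] (a≺t ∷ []) (u≺a ∷ [])
        rewrite ∑-ins-[] L 0 F a | ∑-ins-zero L (F ∘ (fall a t +_)) t [] | ∑-ins-zero L (F ∘ (fall a u +_)) u []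
              | fall≡0 (asym a≺t) | fall≡1 u≺a = poly (F 0) (F 1)
        where
        poly : ∀ x y → x + (y + 0) ≡ 1 * x + 1 * y
        poly = solve-∀
      ∑-insert-extremes F a (b ∷ w) (a≺t ∷ ≺t@(b≺t ∷ _)) (u≺a ∷ ≺u@(u≺b ∷ _))
        rewrite ∑-ins-∷ L 0 F a b w
              | ∑-ins-zero L (F ∘ (fall a t +_)) t (b ∷ w) | ∑-ins-zero L (F ∘ (fall a u +_)) u (b ∷ w)
              | fall≡0 (asym a≺t) | fall≡1 b≺t | fall≡1 u≺a | fall≡0 (asym u≺b)
              | ∑-insert-extremes (F ∘ (fall a b +_)) b w ≺t ≺u
        with does (b ≺? a)
      ... | true  = poly (dsc b w) (asc b w) (F (1 + dsc b w)) (F (2 + dsc b w))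
        where
        poly : ∀ k l x y → x + (x + 0) + ((2 * k + 1) * x + (2 * l + 1) * y)
                           ≡ (2 * suc k + 1) * x + (2 * l + 1) * y
        poly = solve-∀
      ... | false = poly (dsc b w) (asc b w) (F (dsc b w)) (F (1 + dsc b w))
        where
        poly : ∀ k l x y → y + (y + 0) + ((2 * k + 1) * x + (2 * l + 1) * y)
                           ≡ (2 * k + 1) * x + (2 * suc l + 1) * y
        poly = solve-∀

      -- The right side is left nested to expose a factorisation: the brackets are the one-letter
      -- count for k descents and l + 1 ascents, and for k + 1 and l, the two outcomes of inserting
      -- one `t`. Only the totals match, since the left side also contains words with `u` twice.
      ∑-insert-extremes² : ∀ F a w → All (_≺ t) (a ∷ w) → All (u ≺_) (a ∷ w) → let k = dsc a w; l = asc a w in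
        ∑-ins L 2 F a w ≡ suc k * ((2 * k + 1) * F k + (2 * l + 3) * F (suc k))
            + l * ((2 * suc k + 1) * F (suc k) + (2 * l + 1) * F (2 + k))
      ∑-insert-extremes² F a [] (a≺t ∷ []) (u≺a ∷ [])
        rewrite ∑-ins-[] L 1 F a
              | ∑-ins-[] L 0 (F ∘ (fall a t +_)) t | ∑-ins-[] L 0 (F ∘ (fall a u +_)) u
              | ∑-ins-zero L (F ∘ (fall a t +_) ∘ (fall t t +_)) t []
              | ∑-ins-zero L (F ∘ (fall a t +_) ∘ (fall t u +_)) u []
              | ∑-ins-zero L (F ∘ (fall a u +_) ∘ (fall u t +_)) t []
              | ∑-ins-zero L (F ∘ (fall a u +_) ∘ (fall u u +_)) u []
              | fall≡0 (asym a≺t) | fall≡1 u≺a | fall≡0 (irrefl {t} refl) | fall≡0 (irrefl {u} refl)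
              | fall≡1 (≺-trans u≺a a≺t) | fall≡0 (asym (≺-trans u≺a a≺t)) = poly (F 0) (F 1) (F 2)
        where
        poly : ∀ x y z → x + (y + 0) + (y + (y + 0) + 0)
                         ≡ 1 * (1 * x + 3 * y) + 0 * (3 * y + 1 * z)
        poly = solve-∀
      ∑-insert-extremes² F a (b ∷ w) (a≺t ∷ ≺t@(b≺t ∷ _)) (u≺a ∷ ≺u@(u≺b ∷ _))
        rewrite ∑-ins-∷ L 1 F a b w
              | ∑-ins-∷ L 0 (F ∘ (fall a t +_)) t b w | ∑-ins-∷ L 0 (F ∘ (fall a u +_)) u b w
              | ∑-ins-zero L (F ∘ (fall a t +_) ∘ (fall t t +_)) t (b ∷ w)
              | ∑-ins-zero L (F ∘ (fall a t +_) ∘ (fall t u +_)) u (b ∷ w)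
              | ∑-ins-zero L (F ∘ (fall a u +_) ∘ (fall u t +_)) t (b ∷ w)
              | ∑-ins-zero L (F ∘ (fall a u +_) ∘ (fall u u +_)) u (b ∷ w)
              | fall≡0 (asym a≺t) | fall≡1 u≺a | fall≡0 (irrefl {t} refl) | fall≡0 (irrefl {u} refl)
              | fall≡1 (≺-trans u≺a a≺t) | fall≡0 (asym (≺-trans u≺a a≺t))
              | fall≡1 b≺t | fall≡0 (asym u≺b)
              | ∑-insert-extremes (F ∘ suc) b w ≺t ≺u
              | ∑-insert-extremes² (F ∘ (fall a b +_)) b w ≺t ≺u
        with does (b ≺? a)
      ... | true  = poly (dsc b w) (asc b w) (F (1 + dsc b w)) (F (2 + dsc b w)) (F (3 + dsc b w))
        where
        poly : ∀ k l x y z →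
          x + (x + 0) + ((2 * k + 1) * x + (2 * l + 1) * y)
            + (y + (x + 0) + ((2 * k + 1) * x + (2 * l + 1) * y) + 0)
            + (suc k * ((2 * k + 1) * x + (2 * l + 3) * y) + l * ((2 * suc k + 1) * y + (2 * l + 1) * z))
          ≡ suc (suc k) * ((2 * suc k + 1) * x + (2 * l + 3) * y)
            + l * ((2 * suc (suc k) + 1) * y + (2 * l + 1) * z)
        poly = solve-∀
      ... | false = poly (dsc b w) (asc b w) (F (dsc b w)) (F (1 + dsc b w)) (F (2 + dsc b w))
        where
        poly : ∀ k l x y z →
          y + (y + 0) + ((2 * k + 1) * y + (2 * l + 1) * z)
            + (z + (y + 0) + ((2 * k + 1) * y + (2 * l + 1) * z) + 0)
            + (suc k * ((2 * k + 1) * x + (2 * l + 3) * y) + l * ((2 * suc k + 1) * y + (2 * l + 1) * z))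
          ≡ suc k * ((2 * k + 1) * x + (2 * suc l + 3) * y)
            + suc l * ((2 * suc k + 1) * y + (2 * suc l + 1) * z)
        poly = solve-∀

-- Enumeration by insertion

-- `key` is `id` for unsigned and `∣_∣` for signed words, so one argument serves both.
record Enumerates {A : Set} (key : A → ℕ) (M : List ℕ) (S : List (List A)) : Set where
  constructor mkEnumerates
  field
    unique  : Unique S
    members : ∀ σ → σ ∈ S ⇔ (map key σ ↭ M)

open Enumerates

same-members⇒↭ : {B : Set} {xs ys : List B} → Unique xs → Unique ys → (∀ x → x ∈ xs ⇔ x ∈ ys) → xs ↭ ys
same-members⇒↭ xs! ys! xs⇔ys = ∼bag⇒↭ (unique∧set⇒bag xs! ys! (xs⇔ys _))

module _ {A : Set} (key : A → ℕ) where

  enumerates-resp-↭ : ∀ {M N S} → M ↭ N → Enumerates key M S → Enumerates key N S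
  enumerates-resp-↭ M↭N eS = mkEnumerates (unique eS) λ σ → mk⇔
    (λ p → ↭-trans (Equivalence.to (members eS σ) p) M↭N)
    (λ p → Equivalence.from (members eS σ) (↭-trans p (↭-sym M↭N)))

  enumerations-↭ : ∀ {M S S′} → Enumerates key M S → Enumerates key M S′ → S ↭ S′
  enumerations-↭ eS eS′ = same-members⇒↭ (unique eS) (unique eS′) λ σ → mk⇔
    (Equivalence.from (members eS′ σ) ∘ Equivalence.to (members eS σ))
    (Equivalence.from (members eS σ) ∘ Equivalence.to (members eS′ σ))

  remove-letter : ∀ xs {x ys M} → map key (xs ++ x ∷ ys) ↭ key x ∷ M → map key (xs ++ ys) ↭ M
  remove-letter xs {x} {ys} {M} p
    rewrite map-++ key xs (x ∷ ys) | map-++ key xs ys =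
    drop-∷ (↭-trans (↭-sym (shift (key x) (map key xs) (map key ys))) p)

  find-letter : ∀ {v M σ} → map key σ ↭ v ∷ M → ∃ λ x → key x ≡ v × ∃₂ λ xs ys → σ ≡ xs ++ x ∷ ys
  find-letter p with ∈-map⁻ key (∈-resp-↭ (↭-sym p) (here refl))
  ... | x , x∈σ , v≡ = x , sym v≡ , ∈-∃++ x∈σ

module _ {A : Set} {L : List A} where

  insert-letter : ∀ {x} → x ∈ L → ∀ xs {ys} m w →
                  xs ++ ys ∈ insertions L m w → xs ++ x ∷ ys ∈ insertions L (suc m) w
  insert-letter x∈L []       m       []      p           = ∈-cartesianProductWith⁺ _∷_ x∈L p
  insert-letter x∈L []       m       (a ∷ w) p           = ∈-++⁺ˡ (∈-cartesianProductWith⁺ _∷_ x∈L p)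
  insert-letter x∈L (b ∷ xs) zero    (a ∷ w) (here refl) =
    ∈-++⁺ʳ _ (∈-map⁺ (b ∷_) (insert-letter x∈L xs zero w (here refl)))
  insert-letter x∈L (b ∷ xs) (suc m) []      p
    with ∈-cartesianProductWith⁻ _∷_ L (insertions L m []) p
  ... | _ , _ , b∈L , q , refl = ∈-cartesianProductWith⁺ _∷_ b∈L (insert-letter x∈L xs m [] q)
  insert-letter x∈L (b ∷ xs) (suc m) (a ∷ w) p
    with ∈-++⁻ (cartesianProductWith _∷_ L (insertions L m (a ∷ w))) p
  ... | inj₁ p′ with ∈-cartesianProductWith⁻ _∷_ L (insertions L m (a ∷ w)) p′
  ...   | _ , _ , b∈L , q , refl =
    ∈-++⁺ˡ (∈-cartesianProductWith⁺ _∷_ b∈L (insert-letter x∈L xs m (a ∷ w) q))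
  insert-letter x∈L (b ∷ xs) (suc m) (a ∷ w) p | inj₂ p′ with ∈-map⁻ (a ∷_) p′
  ...   | _ , q , refl = ∈-++⁺ʳ _ (∈-map⁺ (a ∷_) (insert-letter x∈L xs (suc m) w q))

  insertions-letter : ∀ m w {σ} → σ ∈ insertions L (suc m) w → ∃ λ x → x ∈ L × x ∈ σ
  insertions-letter m [] p with ∈-cartesianProductWith⁻ _∷_ L (insertions L m []) p
  ... | x , _ , x∈L , _ , refl = x , x∈L , here refl
  insertions-letter m (a ∷ w) p with ∈-++⁻ (cartesianProductWith _∷_ L (insertions L m (a ∷ w))) p
  ... | inj₁ p′ with ∈-cartesianProductWith⁻ _∷_ L (insertions L m (a ∷ w)) p′
  ...   | x , _ , x∈L , _ , refl = x , x∈L , here refl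
  insertions-letter m (a ∷ w) p | inj₂ p′ with ∈-map⁻ (a ∷_) p′
  ...   | _ , q , refl with insertions-letter m w q
  ...     | x , x∈L , x∈σ = x , x∈L , there x∈σ

module _ {A : Set} (key : A → ℕ) (v : ℕ) {L : List A} (key-L : ∀ {x} → x ∈ L → key x ≡ v) where

  insertions-key : ∀ m w {σ} → σ ∈ insertions L m w → map key σ ↭ replicate m v ++ map key w
  insertions-key zero    w       (here refl) = ↭-refl
  insertions-key (suc m) []      p with ∈-cartesianProductWith⁻ _∷_ L (insertions L m []) p
  ... | x , _ , x∈L , q , refl rewrite key-L x∈L = prep v (insertions-key m [] q)
  insertions-key (suc m) (a ∷ w) p with ∈-++⁻ (cartesianProductWith _∷_ L (insertions L m (a ∷ w))) p
  ... | inj₁ p′ with ∈-cartesianProductWith⁻ _∷_ L (insertions L m (a ∷ w)) p′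
  ...   | x , _ , x∈L , q , refl rewrite key-L x∈L = prep v (insertions-key m (a ∷ w) q)
  insertions-key (suc m) (a ∷ w) p | inj₂ p′ with ∈-map⁻ (a ∷_) p′
  ...   | _ , q , refl =
    ↭-trans (prep (key a) (insertions-key (suc m) w q)) (↭-sym (shift (key a) (replicate (suc m) v) (map key w)))

  private
    erase : List A → List A
    erase = filter (λ a → ¬? (key a ≟ v))

    erase-∷ : ∀ {x} σ → x ∈ L → erase (x ∷ σ) ≡ erase σ
    erase-∷ σ x∈L = filter-reject (λ a → ¬? (key a ≟ v)) (λ k≢v → k≢v (key-L x∈L))

  -- Deleting the letters of key `v` recovers the original word, so insertions into different words
  -- are disjoint.
  insertions-erase : ∀ m w → All (λ a → key a ≢ v) w → ∀ {σ} → σ ∈ insertions L m w → erase σ ≡ w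
  insertions-erase zero    w       ≢v (here refl) = filter-all (λ a → ¬? (key a ≟ v)) ≢v
  insertions-erase (suc m) []      ≢v p with ∈-cartesianProductWith⁻ _∷_ L (insertions L m []) p
  ... | x , σ , x∈L , q , refl = trans (erase-∷ σ x∈L) (insertions-erase m [] ≢v q)
  insertions-erase (suc m) (a ∷ w) ≢v@(a≢v ∷ w≢v) p
    with ∈-++⁻ (cartesianProductWith _∷_ L (insertions L m (a ∷ w))) p
  ... | inj₁ p′ with ∈-cartesianProductWith⁻ _∷_ L (insertions L m (a ∷ w)) p′
  ...   | x , σ , x∈L , q , refl = trans (erase-∷ σ x∈L) (insertions-erase m (a ∷ w) ≢v q)
  insertions-erase (suc m) (a ∷ w) ≢v@(a≢v ∷ w≢v) p | inj₂ p′ with ∈-map⁻ (a ∷_) p′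
  ...   | _ , q , refl =
    trans (filter-accept (λ a → ¬? (key a ≟ v)) a≢v) (cong (a ∷_) (insertions-erase (suc m) w w≢v q))

  module _ (L! : Unique L) where

    insertions-unique : ∀ m w → All (λ a → key a ≢ v) w → Unique (insertions L m w)
    insertions-unique zero    w       ≢v          = [] ∷ []
    insertions-unique (suc m) []      ≢v          =
      Unique.cartesianProductWith⁺ _∷_ ∷-injective L! (insertions-unique m [] ≢v)
    insertions-unique (suc m) (a ∷ w) ≢v@(a≢v ∷ w≢v) = Unique.++⁺
      (Unique.cartesianProductWith⁺ _∷_ ∷-injective L! (insertions-unique m (a ∷ w) ≢v))
      (Unique.map⁺ ∷-injectiveʳ (insertions-unique (suc m) w w≢v))
      disjoint
      where
      disjoint : ∀ {σ} → ¬ (σ ∈ cartesianProductWith _∷_ L (insertions L m (a ∷ w))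
                            × σ ∈ map (a ∷_) (insertions L (suc m) w))
      disjoint (p , q) with ∈-cartesianProductWith⁻ _∷_ L (insertions L m (a ∷ w)) p | ∈-map⁻ (a ∷_) q
      ... | _ , _ , a∈L , _ , refl | _ , _ , refl = a≢v (key-L a∈L)

    concatMap-insertions-unique : ∀ m {S} → Unique S → All (All (λ a → key a ≢ v)) S →
                                  Unique (concatMap (insertions L m) S)
    concatMap-insertions-unique m []          []         = []
    concatMap-insertions-unique m {w ∷ S} (w∉S ∷ S!) (w≢v ∷ S≢v) = Unique.++⁺
      (insertions-unique m w w≢v) (concatMap-insertions-unique m S! S≢v) disjoint
      where
      disjoint : ∀ {σ} → ¬ (σ ∈ insertions L m w × σ ∈ concatMap (insertions L m) S)
      disjoint (p , q) with find (∈-concatMap⁻ (insertions L m) {xs = S} q)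
      ... | w′ , w′∈S , r = All.lookup w∉S w′∈S
        (trans (sym (insertions-erase m w w≢v p)) (insertions-erase m w′ (All.lookup S≢v w′∈S) r))

    module _ {M S} (eS : Enumerates key M S) (v∉M : v ∉ M) where

      letters-≢ : ∀ {w} → w ∈ S → All (λ a → key a ≢ v) w
      letters-≢ w∈S = All.tabulate λ a∈w k≡v →
        v∉M (subst (_∈ M) k≡v (∈-resp-↭ (Equivalence.to (members eS _) w∈S) (∈-map⁺ key a∈w)))

      enumerates-insertions-unique : ∀ m → Unique (concatMap (insertions L m) S)
      enumerates-insertions-unique m = concatMap-insertions-unique m (unique eS) (All.tabulate letters-≢)

      ∈-insertions⇒↭ : ∀ m {σ} → σ ∈ concatMap (insertions L m) S → map key σ ↭ replicate m v ++ M
      ∈-insertions⇒↭ m σ∈ with find (∈-concatMap⁻ (insertions L m) {xs = S} σ∈)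
      ... | w , w∈S , p = ↭-trans (insertions-key m w p) (++⁺ˡ (replicate m v) (Equivalence.to (members eS w) w∈S))

      module _ (L-complete : ∀ x → key x ≡ v → x ∈ L) where

        ↭⇒∈-insertions : ∀ m σ → map key σ ↭ replicate m v ++ M → ∃ λ w → w ∈ S × σ ∈ insertions L m w
        ↭⇒∈-insertions zero    σ p = σ , Equivalence.from (members eS σ) p , here refl
        ↭⇒∈-insertions (suc m) σ p with find-letter key p
        ... | x , refl , xs , ys , refl with ↭⇒∈-insertions m (xs ++ ys) (remove-letter key xs p)
        ...   | w , w∈S , q = w , w∈S , insert-letter (L-complete x refl) xs m w q

        enumerates-insertions : ∀ m → Enumerates key (replicate m v ++ M) (concatMap (insertions L m) S)
        enumerates-insertions m = mkEnumerates (enumerates-insertions-unique m) λ σ → mk⇔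
          (∈-insertions⇒↭ m)
          (λ p → let w , w∈S , q = ↭⇒∈-insertions m σ p
                 in ∈-concatMap⁺ (insertions L m) (lose w∈S q))

-- From sums to recurrences for coefficients

indicator : ℕ → ℕ → ℕ
indicator j k = if does (k ≟ j) then 1 else 0

genPoly-∑ : {B : Set} (stat : B → ℕ) (S : List B) (j : ℕ) → genPoly stat S j ≡ ∑ (indicator j ∘ stat) S
genPoly-∑ stat []      j = refl
genPoly-∑ stat (σ ∷ S) j with does (stat σ ≟ j)
... | true  = cong suc (genPoly-∑ stat S j)
... | false = genPoly-∑ stat S j

-- The recurrence of `Step` seen from the source: a word with k descents yields αk + β words with k
-- descents and N - αk with k + 1. It acts on weights, so the outer `weigh` of a composite belongs
-- to the earlier step.
weigh : (α β N : ℕ) → (ℕ → ℕ) → ℕ → ℕ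
weigh α β N F k = (α * k + β) * F k + (N ∸ α * k) * F (suc k)

module _ {B : Set} (stat : B → ℕ) (S : List B) where

  ∑-indicator : (c : ℕ → ℕ) (j : ℕ) →
                ∑ (λ σ → c (stat σ) * indicator j (stat σ)) S ≡ c j * genPoly stat S j
  ∑-indicator c j = trans (∑-cong S (λ {σ} _ → at (stat σ)))
    (trans (sym (*-∑ (c j) (indicator j ∘ stat) S)) (cong (c j *_) (sym (genPoly-∑ stat S j))))
    where
    at : ∀ k → c k * indicator j k ≡ c j * indicator j k
    at k with k ≟ j
    ... | yes refl = refl
    ... | no  k≢j rewrite dec-false (k ≟ j) k≢j = trans (*-zeroʳ (c k)) (sym (*-zeroʳ (c j)))

  ∑-indicator-suc : (c : ℕ → ℕ) (j : ℕ) →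
    ∑ (λ σ → c (stat σ) * indicator j (suc (stat σ))) S ≡ shiftUp (λ i → c i * genPoly stat S i) j
  ∑-indicator-suc c zero    = trans (∑-cong S (λ {σ} _ → *-zeroʳ (c (stat σ)))) (sym (*-∑ 0 (λ _ → 0) S))
  ∑-indicator-suc c (suc i) = ∑-indicator c i

  -- With N = αd + δ, the factor N - α(j - 1) of f_{j-1} is α(d + 1 - j) + δ. The truncated
  -- subtraction is exact up to index d, and beyond it the coefficient vanishes.
  genPoly-step : ∀ {α β δ d N g} → N ≡ α * d + δ → (∀ i → d < i → genPoly stat S i ≡ 0) →
                 (∀ j → g j ≡ ∑ (weigh α β N (indicator j) ∘ stat) S) →
                 Step α β δ d (genPoly stat S) g
  genPoly-step {α} {β} {δ} {d} {_} {g} refl supp g≡ = record { formula = coefficient ; vanishing = beyond }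
    where
    f = genPoly stat S
    recurrence : ∀ j → g j ≡ (α * j + β) * f j + shiftUp (λ i → (α * d + δ ∸ α * i) * f i) j
    recurrence j = trans (g≡ j) (trans
      (∑-+ (λ σ → (α * stat σ + β) * indicator j (stat σ))
           (λ σ → (α * d + δ ∸ α * stat σ) * indicator j (suc (stat σ))) S)
      (cong₂ _+_ (∑-indicator (λ k → α * k + β) j) (∑-indicator-suc (λ k → α * d + δ ∸ α * k) j)))
    coefficient : ∀ j j′ → j + j′ ≡ suc d → g j ≡ (α * j + β) * f j + (α * j′ + δ) * shiftUp f j
    coefficient zero    j′ eq   = trans (recurrence 0) (cong ((α * 0 + β) * f 0 +_) (sym (*-zeroʳ (α * j′ + δ))))
    coefficient (suc i) j′ refl = trans (recurrence (suc i)) (cong (λ c → (α * suc i + β) * f (suc i) + c * f i)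
      (trans (cong (_∸ α * i) (expand α i j′ δ)) (m+n∸m≡n (α * i) (α * j′ + δ))))
      where
      expand : ∀ a i j e → a * (i + j) + e ≡ a * i + (a * j + e)
      expand = solve-∀
    beyond : ∀ j → suc d < j → g j ≡ 0
    beyond (suc j) (s≤s d<j) = trans (recurrence (suc j))
      (cong₂ _+_ (trans (cong ((α * suc j + β) *_) (supp (suc j) (m≤n⇒m≤1+n d<j))) (*-zeroʳ (α * suc j + β)))
                 (trans (cong ((α * d + δ ∸ α * j) *_) (supp j d<j)) (*-zeroʳ (α * d + δ ∸ α * j))))

module _ {A : Set} {_≺_ : Rel A 0ℓ} (_≺?_ : Decidable _≺_) (spo : IsStrictPartialOrder _≡_ _≺_)
         (a : A) {N : ℕ} {w : List A} (|w|≡N : length w ≡ N) where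

  private
    k = descents _≺?_ (a ∷ w)
    l = ascents _≺?_ spo (a ∷ w)

    N≡k+l : N ≡ k + l
    N≡k+l = trans (sym |w|≡N) (sym (descents+ascents _≺?_ spo a w))

  ∑-insertions-max : ∀ F {t} → All (_≺ t) (a ∷ w) →
    ∑ (λ σ → F (descents _≺?_ (a ∷ σ))) (insertions [ t ] 1 w) ≡ weigh 1 1 N F k
  ∑-insertions-max F {t} ≺t
    rewrite ∑-ins-def _≺?_ spo [ t ] 1 F a w | ∑-insert-max _≺?_ spo t F a w ≺t
          | N≡k+l | *-identityˡ k | m+n∸m≡n k l | +-comm k 1 = refl

  -- Doubling turns the binomials into (k + 2)(k + 1) and l (l - 1), which makes the sum factor. The
  -- inner `weigh 1 2 N` is the effect of a second `t` on a word of length N + 1 that already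
  -- contains one.
  2*∑-insertions-max² : ∀ F {t} → All (_≺ t) (a ∷ w) →
    2 * ∑ (λ σ → F (descents _≺?_ (a ∷ σ))) (insertions [ t ] 2 w) ≡ weigh 1 1 N (weigh 1 2 N F) k
  2*∑-insertions-max² F {t} ≺t = trans
    (cong (2 *_) (trans (∑-ins-def _≺?_ spo [ t ] 2 F a w) (∑-insert-max² _≺?_ spo t F a w ≺t)))
    (subst (λ N → _ ≡ weigh 1 1 N (weigh 1 2 N F) k) (sym N≡k+l) (two-maxima k l (F k) (F (1 + k)) (F (2 + k))))
    where
    poly : ∀ k l m x y z → (2 + k) * (1 + k) * x + 2 * ((2 + k) * l * y) + l * m * z
                           ≡ (k + 1) * ((k + 2) * x + l * y) + l * ((suc k + 2) * y + m * z)
    poly = solve-∀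
    double : ∀ p q r x y z → 2 * (p * x + q * y + r * z) ≡ 2 * p * x + 2 * (q * y) + 2 * r * z
    double = solve-∀
    two-maxima : ∀ k l x y z →
      2 * (triangle (2 + k) * x + (2 + k) * l * y + triangle l * z)
        ≡ (1 * k + 1) * ((1 * k + 2) * x + (k + l ∸ 1 * k) * y)
          + (k + l ∸ 1 * k) * ((1 * suc k + 2) * y + (k + l ∸ 1 * suc k) * z)
    -- The difference `k + l ∸ suc k` becomes `l ∸ 1`; its truncation at l = 0 is harmless, as it is
    -- always multiplied by l.
    two-maxima k l x y z
      rewrite *-identityˡ k | m+n∸m≡n k l
            | trans (sym (pred[m∸n]≡m∸[1+n] (k + l) k)) (cong pred (m+n∸m≡n k l))
      = trans (double (triangle (2 + k)) ((2 + k) * l) (triangle l) x y z)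
        (trans (cong₂ (λ p r → p * x + 2 * ((2 + k) * l * y) + r * z) (2*triangle (2 + k)) (2*triangle l))
               (poly k l (l ∸ 1) x y z))

  -- The constant 2N + 3 arises from a word of length N + 1: with k descents it has N + 1 - k
  -- ascents, and 2 (N + 1 - k) + 1 = 2N + 3 - 2k.
  ∑-insertions-extremes² : ∀ F {t u} → All (_≺ t) (a ∷ w) → All (u ≺_) (a ∷ w) →
    ∑ (λ σ → F (descents _≺?_ (a ∷ σ))) (insertions (t ∷ u ∷ []) 2 w)
      ≡ weigh 1 1 N (weigh 2 1 (2 * N + 3) F) k
  ∑-insertions-extremes² F {t} {u} ≺t u≺ = trans
    (trans (∑-ins-def _≺?_ spo (t ∷ u ∷ []) 2 F a w) (∑-insert-extremes² _≺?_ spo t u F a w ≺t u≺))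
    (subst (λ N → _ ≡ weigh 1 1 N (weigh 2 1 (2 * N + 3) F) k) (sym N≡k+l)
      (two-extremes k l (F k) (F (1 + k)) (F (2 + k))))
    where
    expand₁ : ∀ k l → 2 * (k + l) + 3 ≡ 2 * k + (2 * l + 3)
    expand₁ = solve-∀
    expand₂ : ∀ k l → 2 * (k + l) + 3 ≡ 2 * suc k + (2 * l + 1)
    expand₂ = solve-∀
    two-extremes : ∀ k l x y z →
      suc k * ((2 * k + 1) * x + (2 * l + 3) * y) + l * ((2 * suc k + 1) * y + (2 * l + 1) * z)
        ≡ (1 * k + 1) * ((2 * k + 1) * x + (2 * (k + l) + 3 ∸ 2 * k) * y)
          + (k + l ∸ 1 * k) * ((2 * suc k + 1) * y + (2 * (k + l) + 3 ∸ 2 * suc k) * z)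
    two-extremes k l x y z = cong₂ _+_
      (cong₂ (λ p q → p * ((2 * k + 1) * x + q * y))
        (sym (trans (cong (_+ 1) (*-identityˡ k)) (+-comm k 1)))
        (sym (trans (cong (_∸ 2 * k) (expand₁ k l)) (m+n∸m≡n (2 * k) (2 * l + 3)))))
      (cong₂ (λ p q → p * ((2 * suc k + 1) * y + q * z))
        (sym (trans (cong (k + l ∸_) (*-identityˡ k)) (m+n∸m≡n k l)))
        (sym (trans (cong (_∸ 2 * suc k) (expand₂ k l)) (m+n∸m≡n (2 * suc k) (2 * l + 1)))))

-- The four families of words

doubled-suc : ∀ n → replicate 2 (suc n) ++ doubled n ↭ doubled (suc n)
doubled-suc n = ↭-trans (++-comm (replicate 2 (suc n)) (doubled n)) (↭-reflexive (sym (begin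
  doubled (suc n)                        ≡⟨ cong (concatMap dup ∘ map suc) (upTo-∷ʳ n) ⟨
  concatMap dup (map suc (upTo n ++ [ n ]))  ≡⟨ cong (concatMap dup) (map-++ suc (upTo n) [ n ]) ⟩
  concatMap dup ([1⋯ n ] ++ [ suc n ])   ≡⟨ concatMap-++ dup [1⋯ n ] [ suc n ] ⟩
  doubled n ++ suc n ∷ suc n ∷ []        ∎)))
  where
  open ≡-Reasoning
  dup : ℕ → List ℕ
  dup i = i ∷ i ∷ []

doubled⁺-↭ : ∀ n → suc n ∷ doubled n ↭ doubled⁺ n
doubled⁺-↭ n = ++-comm [ suc n ] (doubled n)

length-doubled : ∀ n → length (doubled n) ≡ 2 * n
length-doubled zero    = refl
length-doubled (suc n) = trans (sym (↭-length (doubled-suc n)))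
  (trans (cong (2 +_) (length-doubled n)) (sym (*-suc 2 n)))

∈-doubled⇒≤ : ∀ n {i} → i ∈ doubled n → i ≤ n
∈-doubled⇒≤ n i∈ with ∈-map⁻ suc (∈-doubled n i∈)
... | _ , j∈ , refl = ∈-upTo⁻ j∈

suc∉doubled : ∀ n → suc n ∉ doubled n
suc∉doubled n 1+n∈ = 1+n≰n (∈-doubled⇒≤ n 1+n∈)

module _ {A : Set} (key : A → ℕ) (n : ℕ) {w : List A} (p : map key w ↭ doubled n) where

  keys≤ : All (λ a → key a ≤ n) w
  keys≤ = All.tabulate λ a∈w → ∈-doubled⇒≤ n (∈-resp-↭ p (∈-map⁺ key a∈w))

  doubled-length : length w ≡ 2 * n
  doubled-length = trans (sym (length-map key w)) (trans (↭-length p) (length-doubled n))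

-- These words do not occur in the theorem, so they are built by insertion directly; the filtered
-- lists `D n`, `C± n` and `D± n` must be matched with insertions up to order.
C : ℕ → List (List ℕ)
C zero    = [ [] ]
C (suc n) = concatMap (insertions [ suc n ] 2) (C n)

R : ℕ → Poly
R n = genPoly des (C n)

insert-max-enumerates : ∀ m {n S} → Enumerates id (doubled n) S →
  Enumerates id (replicate m (suc n) ++ doubled n) (concatMap (insertions [ suc n ] m) S)
insert-max-enumerates m {n} eS = enumerates-insertions id (suc n) {L = [ suc n ]} (λ { (here refl) → refl }) ([] ∷ [])
  eS (suc∉doubled n) (λ { _ refl → here refl }) m

C-enumerates : ∀ n → Enumerates id (doubled n) (C n)
C-enumerates zero    = mkEnumerates ([] ∷ []) λ σ → mk⇔ (λ { (here refl) → ↭-refl })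
  λ p → here (trans (sym (map-id σ)) (↭-empty-inv p))
C-enumerates (suc n) = enumerates-resp-↭ id (doubled-suc n) (insert-max-enumerates 2 (C-enumerates n))

D-enumerates : ∀ n → Enumerates id (doubled⁺ n) (D n)
D-enumerates n = mkEnumerates (D-unique n) λ σ →
  subst (λ τ → σ ∈ D n ⇔ (τ ↭ doubled⁺ n)) (sym (map-id σ)) (∈D n σ)

D-↭ : ∀ n → D n ↭ concatMap (insertions [ suc n ] 1) (C n)
D-↭ n = enumerations-↭ id (D-enumerates n)
  (enumerates-resp-↭ id (doubled⁺-↭ n) (insert-max-enumerates 1 (C-enumerates n)))

C±-enumerates : ∀ n → Enumerates ∣_∣ (doubled n) (C± n)
C±-enumerates n = mkEnumerates (C±-unique n) (∈C± n)

±_ : ℕ → List ℤ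
± n = ℤ.+ suc n ∷ -[1+ n ] ∷ []

C±-↭ : ∀ n → C± (suc n) ↭ concatMap (insertions (± n) 2) (C± n)
C±-↭ n = enumerations-↭ ∣_∣ (C±-enumerates (suc n)) (enumerates-resp-↭ ∣_∣ (doubled-suc n)
  (enumerates-insertions ∣_∣ (suc n) {L = ± n} (λ { (here refl) → refl ; (there (here refl)) → refl })
    (((λ ()) ∷ []) ∷ [] ∷ []) (C±-enumerates n) (suc∉doubled n) complete 2))
  where
  complete : ∀ x → ∣ x ∣ ≡ suc n → x ∈ ± n
  complete (ℤ.+ _)  refl = here refl
  complete -[1+ _ ] refl = there (here refl)

-- The sign condition is invisible to `∣_∣`, so `D± n` is no instance of `Enumerates`. Uniqueness is
-- shared with the other families, but membership is shown by removing the positive letter itself.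
D±-↭ : ∀ n → D± n ↭ concatMap (insertions [ ℤ.+ suc n ] 1) (C± n)
D±-↭ n = same-members⇒↭ (D±-unique n)
  (enumerates-insertions-unique ∣_∣ (suc n) key-L ([] ∷ []) (C±-enumerates n) (suc∉doubled n) 1)
  λ σ → mk⇔ (to ∘ Equivalence.to (∈D± n σ)) (Equivalence.from (∈D± n σ) ∘ from)
  where
  key-L : ∀ {x} → x ∈ [ ℤ.+ suc n ] → ∣ x ∣ ≡ suc n
  key-L (here refl) = refl
  to : ∀ {σ} → IsD± n σ → σ ∈ concatMap (insertions [ ℤ.+ suc n ] 1) (C± n)
  to (p , v∈σ) with ∈-∃++ v∈σ
  ... | xs , ys , refl = ∈-concatMap⁺ (insertions [ ℤ.+ suc n ] 1) (lose
    (Equivalence.from (∈C± n (xs ++ ys)) (remove-letter ∣_∣ xs (↭-trans p (↭-sym (doubled⁺-↭ n)))))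
    (insert-letter (here refl) xs 0 (xs ++ ys) (here refl)))
  from : ∀ {σ} → σ ∈ concatMap (insertions [ ℤ.+ suc n ] 1) (C± n) → IsD± n σ
  from σ∈ = ↭-trans (∈-insertions⇒↭ ∣_∣ (suc n) key-L ([] ∷ []) (C±-enumerates n) (suc∉doubled n) 1 σ∈)
                    (doubled⁺-↭ n)
          , letter
    where
    letter : ℤ.+ suc n ∈ _
    letter with find (∈-concatMap⁻ (insertions [ ℤ.+ suc n ] 1) {xs = C± n} σ∈)
    ... | w , _ , σ∈w with insertions-letter 0 w σ∈w
    ...   | _ , here refl , v∈σ = v∈σ

-- No natural number is below 0, so a leading 0 is free. It gives every slot a left neighbour and
-- lets `des` be treated like `desB`.
des-0∷ : ∀ w → descents _<?_ (0 ∷ w) ≡ des w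
des-0∷ []      = refl
des-0∷ (_ ∷ _) = refl

∑-D : ∀ n F → ∑ (F ∘ des) (D n) ≡ ∑ (weigh 1 1 (2 * n) F ∘ des) (C n)
∑-D n F = trans (∑-↭ (F ∘ des) (D-↭ n)) (trans (∑-concatMap (F ∘ des) _ (C n)) (∑-cong (C n) fibre))
  where
  fibre : ∀ {w} → w ∈ C n → ∑ (F ∘ des) (insertions [ suc n ] 1 w) ≡ weigh 1 1 (2 * n) F (des w)
  fibre {w} w∈ = begin
    ∑ (F ∘ des) (insertions [ suc n ] 1 w)   ≡⟨ ∑-cong (insertions [ suc n ] 1 w) (λ {σ} _ → cong F (des-0∷ σ)) ⟨
    ∑ (F ∘ descents _<?_ ∘ (0 ∷_)) (insertions [ suc n ] 1 w)
      ≡⟨ ∑-insertions-max _<?_ <-isStrictPartialOrder 0 (doubled-length id n w↭) F (z<s ∷ All.map s≤s (keys≤ id n w↭)) ⟩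
    weigh 1 1 (2 * n) F (descents _<?_ (0 ∷ w))   ≡⟨ cong (weigh 1 1 (2 * n) F) (des-0∷ w) ⟩
    weigh 1 1 (2 * n) F (des w)              ∎
    where
    open ≡-Reasoning
    w↭ = Equivalence.to (members (C-enumerates n) w) w∈

-- A word of C (suc n) arises from a word of D n in two ways, one for each copy
-- of suc n; hence the factor 2.
2*∑-C : ∀ n F → 2 * ∑ (F ∘ des) (C (suc n)) ≡ ∑ (weigh 1 2 (2 * n) F ∘ des) (D n)
2*∑-C n F = begin
  2 * ∑ (F ∘ des) (C (suc n))  ≡⟨ cong (2 *_) (∑-concatMap (F ∘ des) (insertions [ suc n ] 2) (C n)) ⟩
  2 * ∑ (λ w → ∑ (F ∘ des) (insertions [ suc n ] 2 w)) (C n)  ≡⟨ *-∑ 2 (λ w → ∑ (F ∘ des) (insertions [ suc n ] 2 w)) (C n) ⟩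
  ∑ (λ w → 2 * ∑ (F ∘ des) (insertions [ suc n ] 2 w)) (C n)  ≡⟨ ∑-cong (C n) fibre ⟩
  ∑ (weigh 1 1 (2 * n) (weigh 1 2 (2 * n) F) ∘ des) (C n)  ≡⟨ ∑-D n (weigh 1 2 (2 * n) F) ⟨
  ∑ (weigh 1 2 (2 * n) F ∘ des) (D n) ∎
  where
  open ≡-Reasoning
  fibre : ∀ {w} → w ∈ C n → 2 * ∑ (F ∘ des) (insertions [ suc n ] 2 w)
                            ≡ weigh 1 1 (2 * n) (weigh 1 2 (2 * n) F) (des w)
  fibre {w} w∈ = begin
    2 * ∑ (F ∘ des) (insertions [ suc n ] 2 w)
      ≡⟨ cong (2 *_) (∑-cong (insertions [ suc n ] 2 w) (λ {σ} _ → cong F (des-0∷ σ))) ⟨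
    2 * ∑ (F ∘ descents _<?_ ∘ (0 ∷_)) (insertions [ suc n ] 2 w)
      ≡⟨ 2*∑-insertions-max² _<?_ <-isStrictPartialOrder 0 (doubled-length id n w↭) F (z<s ∷ All.map s≤s (keys≤ id n w↭)) ⟩
    weigh 1 1 (2 * n) (weigh 1 2 (2 * n) F) (descents _<?_ (0 ∷ w))
      ≡⟨ cong (weigh 1 1 (2 * n) (weigh 1 2 (2 * n) F)) (des-0∷ w) ⟩
    weigh 1 1 (2 * n) (weigh 1 2 (2 * n) F) (des w) ∎
    where
    w↭ = Equivalence.to (members (C-enumerates n) w) w∈

∣z∣≤n⇒z<1+n : ∀ {n} z → ∣ z ∣ ≤ n → z ℤ.< ℤ.+ suc n
∣z∣≤n⇒z<1+n (ℤ.+ _)  z≤n′ = +<+ (s≤s z≤n′)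
∣z∣≤n⇒z<1+n -[1+ _ ] _    = -<+

∣z∣≤n⇒-1-n<z : ∀ {n} z → ∣ z ∣ ≤ n → -[1+ n ] ℤ.< z
∣z∣≤n⇒-1-n<z (ℤ.+ _)  _    = -<+
∣z∣≤n⇒-1-n<z -[1+ _ ] z≤n′ = -<- z≤n′

module _ (n : ℕ) {w : List ℤ} (w∈ : w ∈ C± n) where

  private
    w↭ : map ∣_∣ w ↭ doubled n
    w↭ = Equivalence.to (∈C± n w) w∈

  C±-length : length w ≡ 2 * n
  C±-length = doubled-length ∣_∣ n w↭

  C±-< : All (ℤ._< ℤ.+ suc n) (0ℤ ∷ w)
  C±-< = +<+ z<s ∷ All.map (λ {z} → ∣z∣≤n⇒z<1+n z) (keys≤ ∣_∣ n w↭)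

  C±-> : All (-[1+ n ] ℤ.<_) (0ℤ ∷ w)
  C±-> = -<+ ∷ All.map (λ {z} → ∣z∣≤n⇒-1-n<z z) (keys≤ ∣_∣ n w↭)

∑-D± : ∀ n F → ∑ (F ∘ desB) (D± n) ≡ ∑ (weigh 1 1 (2 * n) F ∘ desB) (C± n)
∑-D± n F = trans (∑-↭ (F ∘ desB) (D±-↭ n)) (trans (∑-concatMap (F ∘ desB) (insertions [ ℤ.+ suc n ] 1) (C± n))
  (∑-cong (C± n) λ w∈ → ∑-insertions-max ℤ._<?_ ℤ.<-isStrictPartialOrder 0ℤ (C±-length n w∈) F (C±-< n w∈)))

-- Both sides reduce to `C± n`: the outer `weigh 1 1` of each fibre sum is traded for a sum over
-- `D± n`.
∑-C± : ∀ n F → ∑ (F ∘ desB) (C± (suc n)) ≡ ∑ (weigh 2 1 (2 * (2 * n) + 3) F ∘ desB) (D± n)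
∑-C± n F = begin
  ∑ (F ∘ desB) (C± (suc n))                         ≡⟨ ∑-↭ (F ∘ desB) (C±-↭ n) ⟩
  ∑ (F ∘ desB) (concatMap (insertions (± n) 2) (C± n))  ≡⟨ ∑-concatMap (F ∘ desB) _ (C± n) ⟩
  ∑ (∑ (F ∘ desB) ∘ insertions (± n) 2) (C± n)      ≡⟨ ∑-cong (C± n) (λ w∈ →
    ∑-insertions-extremes² ℤ._<?_ ℤ.<-isStrictPartialOrder 0ℤ (C±-length n w∈) F (C±-< n w∈) (C±-> n w∈)) ⟩
  ∑ (weigh 1 1 (2 * n) (weigh 2 1 (2 * (2 * n) + 3) F) ∘ desB) (C± n)  ≡⟨ ∑-D± n (weigh 2 1 (2 * (2 * n) + 3) F) ⟨
  ∑ (weigh 2 1 (2 * (2 * n) + 3) F ∘ desB) (D± n)   ∎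
  where open ≡-Reasoning

-- The recurrences for the four families, and the induction

module _ (n : ℕ) where

  -- In all four steps δ is N - αd: here (2n + 2) - 2n = 2, then (2n + 2) - (2n + 1) = 1 twice, and
  -- (4n + 3) - 4n = 3.
  Q-step : AlternatinglyIncreasing (2 * n) (R (suc n)) → Step 1 1 2 (2 * n) (R (suc n)) (Q (suc n))
  Q-step alt = genPoly-step des (C (suc n)) {δ = 2} (arith n) (proj₂ (degree alt))
    λ j → trans (genPoly-∑ des (D (suc n)) j) (∑-D (suc n) (indicator j))
    where
    arith : ∀ n → 2 * suc n ≡ 1 * (2 * n) + 2
    arith = solve-∀

  R-step : AlternatinglyIncreasing (suc (2 * n)) (Q (suc n)) →
           Step 1 2 1 (suc (2 * n)) (Q (suc n)) (λ j → 2 * R (2 + n) j)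
  R-step alt = genPoly-step des (D (suc n)) {δ = 1} (arith n) (proj₂ (degree alt))
    λ j → trans (cong (2 *_) (genPoly-∑ des (C (2 + n)) j)) (2*∑-C (suc n) (indicator j))
    where
    arith : ∀ n → 2 * suc n ≡ 1 * suc (2 * n) + 1
    arith = solve-∀

  T-step : AlternatinglyIncreasing (suc (2 * n)) (S (suc n)) →
           Step 1 1 1 (suc (2 * n)) (S (suc n)) (T (suc n))
  T-step alt = genPoly-step desB (C± (suc n)) {δ = 1} (arith n) (proj₂ (degree alt))
    λ j → trans (genPoly-∑ desB (D± (suc n)) j) (∑-D± (suc n) (indicator j))
    where
    arith : ∀ n → 2 * suc n ≡ 1 * suc (2 * n) + 1
    arith = solve-∀

  S-step : AlternatinglyIncreasing (2 * n) (T n) → Step 2 1 3 (2 * n) (T n) (S (suc n))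
  S-step alt = genPoly-step desB (D± n) refl (proj₂ (degree alt))
    λ j → trans (genPoly-∑ desB (C± (suc n)) j) (∑-C± n (indicator j))

constant-alternatinglyIncreasing : ∀ {f} → f 0 ≢ 0 → (∀ i → f (suc i) ≡ 0) → AlternatinglyIncreasing 0 f
constant-alternatinglyIncreasing {f} f₀≢0 fᵢ≡0 = mkAlt
  (f₀≢0 , λ { (suc i) _ → fᵢ≡0 i })
  (λ { zero zero _ _ → ≤-refl })
  (λ { zero _ refl _ → subst (_≤ f 0) (sym (fᵢ≡0 0)) z≤n ; (suc zero) zero _ () })

Q-alternatinglyIncreasing-step : ∀ n → AlternatinglyIncreasing (2 * n) (R (suc n)) →
                                 AlternatinglyIncreasing (suc (2 * n)) (Q (suc n))
Q-alternatinglyIncreasing-step n alt =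
  step-alternatinglyIncreasing (Q-step n alt) alt (s≤s z≤n) (s≤s z≤n) ≤-refl

-- The induction starts at R_1 = 1 because the degree 2n - 2 of R_n is wrong for n = 0. Symmetry is
-- carried along since it supplies the rising half at the next stage.
R-symmetric-alternatinglyIncreasing : ∀ n → Symmetric (2 * n) (R (suc n)) × AlternatinglyIncreasing (2 * n) (R (suc n))
R-symmetric-alternatinglyIncreasing zero    =
  (λ { zero zero _ → refl }) , constant-alternatinglyIncreasing (λ ()) (λ _ → refl)
R-symmetric-alternatinglyIncreasing (suc n) with R-symmetric-alternatinglyIncreasing n
... | sy , alt rewrite *-suc 2 n =
  two-steps-symmetric step₁ step₂ (proj₂ (degree alt)) sy ,
  two-steps-alternatinglyIncreasing step₁ step₂ (proj₂ (degree alt)) sy altQ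
  where
  altQ = Q-alternatinglyIncreasing-step n alt
  step₁ = Q-step n alt
  step₂ = R-step n altQ

Q-alternatinglyIncreasing : ∀ n → AlternatinglyIncreasing (suc (2 * n)) (Q (suc n))
Q-alternatinglyIncreasing n = Q-alternatinglyIncreasing-step n (proj₂ (R-symmetric-alternatinglyIncreasing n))

mutual

  -- The base is T_0 = 1, from the single word 1. The constants only just suffice: β = δ in the step
  -- from S to T, and δ = α + β in the step from T to S.
  T-alternatinglyIncreasing : ∀ n → AlternatinglyIncreasing (2 * n) (T n)
  T-alternatinglyIncreasing zero    = constant-alternatinglyIncreasing (λ ()) (λ _ → refl)
  T-alternatinglyIncreasing (suc n) = subst (λ d → AlternatinglyIncreasing d (T (suc n))) (sym (*-suc 2 n))
    (step-alternatinglyIncreasing (T-step n alt) alt ≤-refl ≤-refl (s≤s z≤n))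
    where
    alt = S-alternatinglyIncreasing n

  S-alternatinglyIncreasing : ∀ n → AlternatinglyIncreasing (suc (2 * n)) (S (suc n))
  S-alternatinglyIncreasing n = step-alternatinglyIncreasing (S-step n alt) alt (s≤s z≤n) (s≤s z≤n) ≤-refl
    where
    alt = T-alternatinglyIncreasing n

theorem3 : (n : ℕ) → 1 ≤ n →
    UnimodalWithModeInTheMiddle (Q n) (2 * n ∸ 1) ×
    UnimodalWithModeInTheMiddle (S n) (2 * n ∸ 1) ×
    UnimodalWithModeInTheMiddle (T n) (2 * n) ×
    ⌊ (2 * n ∸ 1) + 1 /2⌋ ≡ n ×
    ⌊ 2 * n + 1 /2⌋ ≡ n
theorem3 (suc n) _ =
  subst (UnimodalWithModeInTheMiddle (Q (suc n))) d≡ (alternatinglyIncreasing⇒unimodal (Q-alternatinglyIncreasing n)) ,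
  subst (UnimodalWithModeInTheMiddle (S (suc n))) d≡ (alternatinglyIncreasing⇒unimodal (S-alternatinglyIncreasing n)) ,
  alternatinglyIncreasing⇒unimodal (T-alternatinglyIncreasing (suc n)) ,
  odd-middle ,
  even-middle
  where
  d≡ : suc (2 * n) ≡ 2 * suc n ∸ 1
  d≡ = cong pred (sym (*-suc 2 n))
  odd-middle : ⌊ (2 * suc n ∸ 1) + 1 /2⌋ ≡ suc n
  odd-middle = trans (cong ⌊_/2⌋ (arith n)) (sym (n≡⌊n+n/2⌋ (suc n)))
    where
    arith : ∀ n → n + suc (n + 0) + 1 ≡ suc n + suc n
    arith = solve-∀
  even-middle : ⌊ 2 * suc n + 1 /2⌋ ≡ suc n
  even-middle = trans (cong ⌊_/2⌋ (arith n)) (sym (n≡⌈n+n/2⌉ (suc n)))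
    where
    arith : ∀ n → 2 * suc n + 1 ≡ suc (suc n + suc n)
    arith = solve-∀
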